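{- Let $F$ be a simple graph of order $n\ge1$ and let $V_k=\{v_1,\ldots,v_k\}\subseteq V(F)$ with $|V_k|=k$. Let $H_u$ and $H_v$ be two disjoint simple graphs of order $m$ with specified vertices $u$ of $H_u$ and $v$ of $H_v$, each of degree $m-1$ in its graph, such that $H_u-u$ and $H_v-v$ are $r_1$-regular, where $m\ge2$ and $r_1\ge1$. If $H_u$ and $H_v$ are $Q$-cospectral, then $G[F,V_k,H_u]$ and $G[F,V_k,H_v]$ are $Q$-cospectral.
   Context: All graphs are finite and simple. $Q(X)=D(X)+A(X)$ is the signless Laplacian matrix of a graph $X$ ($D$ the diagonal degree matrix, $A$ the adjacency matrix). Two graphs are $Q$-cospectral if their signless Laplacian matrices have the same spectrum (with multiplicities). Graph with $k$ pockets: for a graph $H_w$ with specified vertex $w$, $G[F,V_k,H_w]$ is obtained by taking one copy of $F$ and $k$ vertex-disjoint copies of $H_w$, and, for each $i=1,\ldots,k$, identifying the vertex $w$ of the $i$th copy of $H_w$ with the vertex $v_i$ of $F$. -}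

module Defs where

open import Algebra.Apartness.Bundles using (HeytingField; HeytingCommutativeRing)
open import Algebra.Bundles using (CommutativeRing)
open import Algebra.Bundles.Raw using (RawRing)
import Algebra.Definitions.RawSemiring as RawSemiringDefs
open import Data.Bool.Base using (Bool; true; false; if_then_else_; _∧_)
open import Data.Bool.Properties using (∧-zeroʳ)
open import Data.Fin.Base using (Fin; zero; suc; toℕ; punchIn; splitAt; remQuot)
open import Data.Fin.Properties using (_≟_)
open import Data.Fin.Subset using (Subset; ∣_∣)
open import Data.List.Base using (List; []; _∷_; map; foldr; _++_)
open import Data.Nat.Base as ℕ using (ℕ; zero; suc)
open import Data.Product.Base using (∃; _×_; _,_)
open import Data.Sum.Base using (_⊎_; inj₁; inj₂)
open import Data.Vec.Base using (tabulate)
open import Level using (Level; _⊔_)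
open import Relation.Binary.PropositionalEquality
  using (_≡_; refl; sym; cong; cong₂; trans)
open import Relation.Nullary.Decidable using (⌊_⌋; yes; no)
open import Relation.Nullary.Negation using (contradiction)

------------------------------------------------------------------------
-- Finite simple graphs

record Graph (n : ℕ) : Set where
  field
    adj        : Fin n → Fin n → Bool
    adj-sym    : ∀ x y → adj x y ≡ adj y x
    adj-irrefl : ∀ x → adj x x ≡ false

open Graph public

neighbours : ∀ {n} → Graph n → Fin n → Subset n
neighbours X x = tabulate (adj X x)

degree : ∀ {n} → Graph n → Fin n → ℕ
degree X x = ∣ neighbours X x ∣

Regular : ∀ {n} → ℕ → Graph n → Set
Regular r X = ∀ x → degree X x ≡ r

infixl 6 _-ᵛ_

-- Vertex deletion; `punchIn w` enumerates the vertices other than w.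
_-ᵛ_ : ∀ {p} → Graph (suc p) → Fin (suc p) → Graph p
adj        (H -ᵛ w) x y = adj H (punchIn w x) (punchIn w y)
adj-sym    (H -ᵛ w) x y = adj-sym H (punchIn w x) (punchIn w y)
adj-irrefl (H -ᵛ w) x   = adj-irrefl H (punchIn w x)

------------------------------------------------------------------------
-- Graphs with pockets

module _ {n k p : ℕ} (F : Graph n) (v : Fin k → Fin n)
         (H : Graph (suc p)) (w : Fin (suc p)) where

  -- `inj₁ a` is the vertex a of F and `inj₂ (i , y)` is the vertex
  -- `punchIn w y` of the i-th copy of H; the vertex w of the i-th copy has
  -- been identified with `v i` and so does not occur a second time.
  PocketVertex : Set
  PocketVertex = Fin n ⊎ (Fin k × Fin p)

  pocketAdj : PocketVertex → PocketVertex → Bool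
  pocketAdj (inj₁ a)       (inj₁ b)       = adj F a b
  pocketAdj (inj₁ a)       (inj₂ (i , y)) = ⌊ a ≟ v i ⌋ ∧ adj H w (punchIn w y)
  pocketAdj (inj₂ (i , y)) (inj₁ b)       = ⌊ b ≟ v i ⌋ ∧ adj H (punchIn w y) w
  pocketAdj (inj₂ (i , y)) (inj₂ (j , z)) = ⌊ i ≟ j ⌋ ∧ adj H (punchIn w y) (punchIn w z)

  pocketAdj-sym : ∀ s t → pocketAdj s t ≡ pocketAdj t s
  pocketAdj-sym (inj₁ a)       (inj₁ b)       = adj-sym F a b
  pocketAdj-sym (inj₁ a)       (inj₂ (i , y)) = cong (⌊ a ≟ v i ⌋ ∧_) (adj-sym H _ _)
  pocketAdj-sym (inj₂ (i , y)) (inj₁ b)       = cong (⌊ b ≟ v i ⌋ ∧_) (adj-sym H _ _)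
  pocketAdj-sym (inj₂ (i , y)) (inj₂ (j , z)) = cong₂ _∧_ (≟-sym i j) (adj-sym H _ _)
    where
    ≟-sym : ∀ {m} (a b : Fin m) → ⌊ a ≟ b ⌋ ≡ ⌊ b ≟ a ⌋
    ≟-sym a b with a ≟ b | b ≟ a
    ... | yes _  | yes _  = refl
    ... | yes eq | no ≢   = contradiction (sym eq) ≢
    ... | no ≢   | yes eq = contradiction (sym eq) ≢
    ... | no _   | no _   = refl

  pocketAdj-irrefl : ∀ s → pocketAdj s s ≡ false
  pocketAdj-irrefl (inj₁ a)       = adj-irrefl F a
  pocketAdj-irrefl (inj₂ (i , y)) =
    trans (cong (⌊ i ≟ i ⌋ ∧_) (adj-irrefl H _)) (∧-zeroʳ ⌊ i ≟ i ⌋)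

pocketVertex : ∀ n k p → Fin (n ℕ.+ k ℕ.* p) → Fin n ⊎ (Fin k × Fin p)
pocketVertex n k p x with splitAt n x
... | inj₁ a = inj₁ a
... | inj₂ b = inj₂ (remQuot p b)

-- G[F, V_k, H_w] for V_k = {v 0, …, v (k - 1)}.
G[_,_,_,_] : ∀ {n k p} → Graph n → (Fin k → Fin n) →
             (H : Graph (suc p)) → Fin (suc p) → Graph (n ℕ.+ k ℕ.* p)
G[_,_,_,_] {n} {k} {p} F v H w = record
  { adj        = λ x y → pocketAdj F v H w (vertex x) (vertex y)
  ; adj-sym    = λ x y → pocketAdj-sym F v H w (vertex x) (vertex y)
  ; adj-irrefl = λ x → pocketAdj-irrefl F v H w (vertex x)
  }
  where vertex = pocketVertex n k p

------------------------------------------------------------------------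
-- Matrices

Matrix : ∀ {a} → Set a → ℕ → Set a
Matrix A n = Fin n → Fin n → A

module _ {c ℓ} (R : RawRing c ℓ) where
  open RawRing R
  open RawSemiringDefs rawSemiring using (_^_; sum) renaming (_×_ to _·_)

  -- Laplace expansion along the first row.
  det : ∀ {n} → Matrix Carrier n → Carrier
  det {zero}  M = 1#
  det {suc n} M =
    sum λ j → (- 1#) ^ toℕ j * (M zero j * det λ a b → M (suc a) (punchIn j b))

  adjacencyMatrix : ∀ {n} → Graph n → Matrix Carrier n
  adjacencyMatrix X x y = if adj X x y then 1# else 0#

  degreeMatrix : ∀ {n} → Graph n → Matrix Carrier n
  degreeMatrix X x y = if ⌊ x ≟ y ⌋ then degree X x · 1# else 0#

  signlessLaplacian : ∀ {n} → Graph n → Matrix Carrier n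
  signlessLaplacian X x y = degreeMatrix X x y + adjacencyMatrix X x y

------------------------------------------------------------------------
-- Univariate polynomials

-- a₀ ∷ a₁ ∷ … ∷ [] represents a₀ + a₁ X + …; trailing zeros are allowed, so
-- equality is coefficientwise and not equality of lists.
module Polynomial {c ℓ} (R : RawRing c ℓ) where
  open RawRing R

  Poly : Set c
  Poly = List Carrier

  coeff : Poly → ℕ → Carrier
  coeff []      i       = 0#
  coeff (a ∷ p) zero    = a
  coeff (a ∷ p) (suc i) = coeff p i

  infixl 6 _+ₚ_
  infixl 7 _*ₚ_
  infix  4 _≈ₚ_

  _≈ₚ_ : Poly → Poly → Set ℓ
  p ≈ₚ q = ∀ i → coeff p i ≈ coeff q i

  _+ₚ_ : Poly → Poly → Poly
  []      +ₚ q       = q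
  (a ∷ p) +ₚ []      = a ∷ p
  (a ∷ p) +ₚ (b ∷ q) = a + b ∷ p +ₚ q

  _*ₚ_ : Poly → Poly → Poly
  []      *ₚ q = []
  (a ∷ p) *ₚ q = map (a *_) q +ₚ (0# ∷ p *ₚ q)

  -ₚ_ : Poly → Poly
  -ₚ_ = map -_

  constant : Carrier → Poly
  constant a = a ∷ []

  X : Poly
  X = 0# ∷ 1# ∷ []

  polyRing : RawRing c ℓ
  polyRing = record
    { Carrier = Poly
    ; _≈_ = _≈ₚ_
    ; _+_ = _+ₚ_
    ; _*_ = _*ₚ_
    ; -_  = -ₚ_
    ; 0#  = []
    ; 1#  = constant 1#
    }

  eval : Poly → Carrier → Carrier
  eval []      x = 0#
  eval (a ∷ p) x = a + x * eval p x

  -- det (X I - M)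
  charPoly : ∀ {n} → Matrix Carrier n → Poly
  charPoly M = det polyRing λ i j →
    (if ⌊ i ≟ j ⌋ then X else []) +ₚ (-ₚ constant (M i j))

  ∏[X-_] : List Carrier → Poly
  ∏[X- λs ] = foldr (λ μ q → (X +ₚ (-ₚ constant μ)) *ₚ q) (constant 1#) λs

------------------------------------------------------------------------
-- Spectra over a field

-- The intended K is any algebraically closed field of characteristic zero, e.g.
-- ℂ, so that every integer matrix has all of its eigenvalues in K.
module _ {c ℓ₁ ℓ₂} (K : HeytingField c ℓ₁ ℓ₂) where
  open HeytingField K

  fieldRawRing : RawRing c ℓ₁
  fieldRawRing = CommutativeRing.rawRing
    (HeytingCommutativeRing.commutativeRing heytingCommutativeRing)

  open Polynomial fieldRawRing
  open RawSemiringDefs (RawRing.rawSemiring fieldRawRing)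
    using () renaming (_×_ to _·_)

  CharacteristicZero : Set ℓ₂
  CharacteristicZero = ∀ n → suc n · 1# # 0#

  -- Every monic polynomial a₀ + a₁ X + … + Xᵈ with d ≥ 1 has a root.
  AlgebraicallyClosed : Set (c ⊔ ℓ₁)
  AlgebraicallyClosed =
    ∀ a₀ as → ∃ λ x → eval (a₀ ∷ as ++ 1# ∷ []) x ≈ 0#

  -- λs lists the eigenvalues of M, each as often as its algebraic
  -- multiplicity. The order is irrelevant: every permutation of a spectrum is
  -- a spectrum.
  IsSpectrum : ∀ {n} → Matrix Carrier n → List Carrier → Set ℓ₁
  IsSpectrum M λs = charPoly M ≈ₚ ∏[X- λs ]

  -- Q(Y) and Q(Z) have the same eigenvalues with the same multiplicities.
  QCospectral : ∀ {m n} → Graph m → Graph n → Set (c ⊔ ℓ₁)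
  QCospectral Y Z = ∃ λ λs →
    IsSpectrum (signlessLaplacian fieldRawRing Y) λs ×
    IsSpectrum (signlessLaplacian fieldRawRing Z) λs

{-# OPTIONS --safe #-}

-- Let c = x - 1 - 2r₁ and let N be the part of xI - Q(H_w) indexed by H_w - w.
-- Every column of N sums to c, so replacing a row of a vertex of attachment by
-- c times itself plus the rows of its pocket clears the entries of that row in
-- the pocket columns. For H_w itself this gives
--   c · det (xI - Q(H_w)) = (c (x - p) - p) · det N,
-- and for the pocket graph, with T independent of the internal structure of H_w,
--   cⁿ · det (xI - Q(G[F, V_k, H_w])) = det T · (det N)ᵏ.
-- The factors c and c (x - p) - p are monic in x, hence can be cancelled: the
-- first identity shows that det N depends on the spectrum of H_w only, and then
-- the second one shows the same for the pocket graph.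
module Submission where

open import Algebra.Apartness.Bundles using (HeytingField; HeytingCommutativeRing)
open import Algebra.Bundles using (CommutativeRing)
open import Algebra.Bundles.Raw using (RawRing)
open import Data.Bool.Base using (Bool; true; false; if_then_else_; _∧_)
open import Data.Bool.Properties using (∧-identityʳ)
open import Data.Fin.Base using (Fin; zero; suc; toℕ; punchIn; punchOut; splitAt; combine; quotient; _↑ˡ_; _↑ʳ_)
open import Data.Fin.Permutation as Perm using (Permutation′; _⟨$⟩ʳ_; _⟨$⟩ˡ_)
open import Data.Fin.Properties
  using (_≟_; suc-injective; punchIn-punchOut; punchIn-injective; punchInᵢ≢i; toℕ-↑ˡ;
         splitAt-↑ˡ; splitAt-↑ʳ; splitAt⁻¹-↑ˡ; splitAt⁻¹-↑ʳ; ↑ʳ-injective;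
         remQuot-combine; combine-injectiveˡ; combine-injectiveʳ; combine-surjective)
open import Data.Fin.Subset using (⊤) renaming (∣_∣ to ∣_∣ˢ)
open import Data.Fin.Subset.Properties using (∣p∣≡n⇒p≡⊤)
open import Data.List.Base using (List; []; _∷_; _++_; map; length)
open import Data.Nat.Base as ℕ using (ℕ; zero; suc; z≤n; s≤s; _≤_; _∸_)
import Data.Nat.Properties as ℕ
open import Data.Product.Base using (∃; ∃₂; _×_; _,_; proj₁)
open import Data.Sum.Base using (_⊎_; inj₁; inj₂; [_,_]′)
open import Data.Vec.Base using (tabulate; lookup)
open import Data.Vec.Functional using (Vector; insertAt) renaming (_∷_ to infixr 5 _∷ᵛ_)
open import Data.Vec.Functional.Properties using (insertAt-lookup; insertAt-punchIn)
open import Data.Vec.Properties using (lookup∘tabulate; lookup-replicate; tabulate-cong)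
open import Function.Base using (_∘_)
open import Function.Definitions using (Injective)
open import Level using (_⊔_)
open import Relation.Binary.PropositionalEquality as ≡ using (_≡_; _≢_)
open import Relation.Nullary.Decidable using (⌊_⌋; yes; no)
open import Relation.Nullary.Negation using (contradiction)
open import Defs

-- Finite sets

-- The constant in c is forced by the cone: a vertex of H_w - w has degree r₁ + 1, one neighbour
-- being w, and r₁ neighbours inside H_w - w, so its column of N adds up to x - (r₁ + 1) - r₁. Thus
-- the all-ones row is a left eigenvector of N with eigenvalue c, and summing the rows of a pocket
-- does the work of the inverse of N in a Schur complement. Over K[X] neither N nor c is invertible,
-- hence the identities are kept free of division and c is cancelled at the end. All n rows of F are
-- scaled, also those without a pocket, whence the exponent n. T does not see the inside of a pocket
-- because w is adjacent to every other vertex of its copy: all entries between a pocket and its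
-- vertex of attachment are -1. Two demands shape the rest. The determinant is a bare Laplace
-- expansion, so its behaviour under products, transposes and blocks has to be derived over an
-- arbitrary commutative ring in order to be usable over K[X]. And cospectrality asks for a list of
-- eigenvalues, so equality of the characteristic polynomials is not enough: they must also be split
-- into linear factors.

⌊≟⌋-refl : ∀ {n} (i : Fin n) → ⌊ i ≟ i ⌋ ≡ true
⌊≟⌋-refl i with i ≟ i
... | yes _  = ≡.refl
... | no i≢i = contradiction ≡.refl i≢i

⌊≟⌋-≢ : ∀ {n} {i j : Fin n} → i ≢ j → ⌊ i ≟ j ⌋ ≡ false
⌊≟⌋-≢ {i = i} {j} i≢j with i ≟ j
... | yes i≡j = contradiction i≡j i≢j
... | no _    = ≡.refl

⌊≟⌋-injective : ∀ {m n} {f : Fin m → Fin n} → (∀ {i j} → f i ≡ f j → i ≡ j) →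
                ∀ i j → ⌊ f i ≟ f j ⌋ ≡ ⌊ i ≟ j ⌋
⌊≟⌋-injective {f = f} inj i j with i ≟ j
... | yes ≡.refl = ⌊≟⌋-refl (f i)
... | no i≢j     = ⌊≟⌋-≢ (i≢j ∘ inj)

punchIn-view : ∀ {n} (j c : Fin (suc n)) → c ≡ j ⊎ ∃ λ k → c ≡ punchIn j k
punchIn-view j c with j ≟ c
... | yes j≡c = inj₁ (≡.sym j≡c)
... | no j≢c  = inj₂ (punchOut j≢c , ≡.sym (punchIn-punchOut j≢c))

punchIn-↑ˡ : ∀ {a} b (j : Fin (suc a)) (i : Fin a) →
             punchIn (j ↑ˡ b) (i ↑ˡ b) ≡ punchIn j i ↑ˡ b
punchIn-↑ˡ b zero    i       = ≡.refl
punchIn-↑ˡ b (suc j) zero    = ≡.refl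
punchIn-↑ˡ b (suc j) (suc i) = ≡.cong suc (punchIn-↑ˡ b j i)

-- Deleting a column of the left block shifts the right block as a whole, so the minors of a block
-- triangular matrix keep its lower right block.
punchIn-↑ʳ : ∀ {a b} (j : Fin (suc a)) (y : Fin b) →
             punchIn (j ↑ˡ b) (a ↑ʳ y) ≡ suc a ↑ʳ y
punchIn-↑ʳ               zero    y = ≡.refl
punchIn-↑ʳ {a = suc a} (suc j) y = ≡.cong suc (punchIn-↑ʳ j y)

-- Alternation is developed for consecutive indices: their Laplace signs are opposite, and deleting
-- either of two equal neighbouring columns gives the same minor, with no permutation to account
-- for.
data Adjacent : ∀ {n} → Fin n → Fin n → Set where
  here  : ∀ {n} → Adjacent {suc (suc n)} zero (suc zero)
  there : ∀ {n} {i j : Fin n} → Adjacent i j → Adjacent (suc i) (suc j)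

Adjacent⇒≢ : ∀ {n} {i j : Fin n} → Adjacent i j → i ≢ j
Adjacent⇒≢ (there i~j) eq = Adjacent⇒≢ i~j (suc-injective eq)

-- The two enumerations differ only at the place where the surviving neighbour sits.
Adjacent-punchIn : ∀ {n} {i j : Fin (suc n)} → Adjacent i j → ∀ b →
                   punchIn i b ≡ punchIn j b ⊎ (punchIn i b ≡ j × punchIn j b ≡ i)
Adjacent-punchIn here        zero    = inj₂ (≡.refl , ≡.refl)
Adjacent-punchIn here        (suc b) = inj₁ ≡.refl
Adjacent-punchIn (there i~j) zero    = inj₁ ≡.refl
Adjacent-punchIn (there i~j) (suc b) with Adjacent-punchIn i~j b
... | inj₁ eq        = inj₁ (≡.cong suc eq)
... | inj₂ (eq , eq′) = inj₂ (≡.cong suc eq , ≡.cong suc eq′)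

-- Nothing lies between neighbours, so deleting a third index leaves them neighbours; this carries
-- alternation down to the minors.
Adjacent-punchOut : ∀ {n} {i j : Fin (suc n)} → Adjacent i j → ∀ l → l ≢ i → l ≢ j →
                    ∃₂ λ i′ j′ → Adjacent i′ j′ × punchIn l i′ ≡ i × punchIn l j′ ≡ j
Adjacent-punchOut here zero l≢i l≢j = contradiction ≡.refl l≢i
Adjacent-punchOut here (suc zero) l≢i l≢j = contradiction ≡.refl l≢j
Adjacent-punchOut here (suc (suc zero)) l≢i l≢j = _ , _ , here , ≡.refl , ≡.refl
Adjacent-punchOut here (suc (suc (suc l))) l≢i l≢j = _ , _ , here , ≡.refl , ≡.refl
Adjacent-punchOut (there i~j) zero l≢i l≢j = _ , _ , i~j , ≡.refl , ≡.refl
Adjacent-punchOut {suc n} (there i~j) (suc l) l≢i l≢j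
  with _ , _ , i′~j′ , eqᵢ , eqⱼ ← Adjacent-punchOut i~j l (l≢i ∘ ≡.cong suc) (l≢j ∘ ≡.cong suc)
  = _ , _ , there i′~j′ , ≡.cong suc eqᵢ , ≡.cong suc eqⱼ

↑ˡ≢↑ʳ : ∀ {m n} (i : Fin m) (j : Fin n) → i ↑ˡ n ≢ m ↑ʳ j
↑ˡ≢↑ʳ {m} {n} i j eq with () ← ≡.trans (≡.sym (splitAt-↑ˡ m i n)) (≡.trans (≡.cong (splitAt m) eq) (splitAt-↑ʳ m n j))

-- Determinants

module Determinant {c ℓ} (R : CommutativeRing c ℓ) where
  open CommutativeRing R hiding (zero) renaming (Carrier to A)
  open import Algebra.Properties.Ring ring
  open import Algebra.Properties.Semiring.Sum semiring
  open import Algebra.Definitions.RawSemiring (RawRing.rawSemiring rawRing) using (_^_)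
  open import Algebra.Solver.Ring.NaturalCoefficients.Default commutativeSemiring
    using (solve; _:=_; _:+_; _:*_; con)
  open import Relation.Binary.Reasoning.Setoid setoid

  ∣_∣ : ∀ {n} → Matrix A n → A
  ∣_∣ = det rawRing

  δ : ∀ {n} → Matrix A n
  δ i j = if ⌊ i ≟ j ⌋ then 1# else 0#

  infixl 7 _⊛_

  _⊛_ : ∀ {n} → Matrix A n → Matrix A n → Matrix A n
  (M ⊛ N) i j = sum λ l → M i l * N l j

  minor : ∀ {n} → Fin (suc n) → Matrix A (suc n) → Matrix A n
  minor j M a b = M (suc a) (punchIn j b)

  sign : ∀ {n} → Fin n → A
  sign j = (- 1#) ^ toℕ j

  infix 4 _≋_

  _≋_ : ∀ {m n} → (M N : Fin m → Fin n → A) → Set ℓ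
  M ≋ N = ∀ i j → M i j ≈ N i j

  -- Kronecker delta and finite sums

  δ-refl : ∀ {n} (i : Fin n) → δ i i ≈ 1#
  δ-refl i rewrite ⌊≟⌋-refl i = refl

  δ-≢ : ∀ {n} {i j : Fin n} → i ≢ j → δ i j ≈ 0#
  δ-≢ i≢j rewrite ⌊≟⌋-≢ i≢j = refl

  δ-injective : ∀ {m n} {f : Fin m → Fin n} → (∀ {i j} → f i ≡ f j → i ≡ j) →
                ∀ i j → δ (f i) (f j) ≈ δ i j
  δ-injective inj i j rewrite ⌊≟⌋-injective inj i j = refl

  sum-zero : ∀ {n} {t : Vector A n} → (∀ i → t i ≈ 0#) → sum t ≈ 0#
  sum-zero {n} t≈0 = trans (sum-cong-≋ t≈0) (sum-replicate-zero n)

  sum-single : ∀ {n} i (t : Vector A n) → (∀ j → j ≢ i → t j ≈ 0#) → sum t ≈ t i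
  sum-single zero t t≈0 =
    trans (+-congˡ (sum-zero λ j → t≈0 (suc j) λ ())) (+-identityʳ _)
  sum-single (suc i) t t≈0 =
    trans (+-cong (t≈0 zero λ ()) (sum-single i (t ∘ suc) λ j j≢i → t≈0 (suc j) (j≢i ∘ suc-injective)))
          (+-identityˡ _)

  sum-δˡ : ∀ {n} i (t : Vector A n) → sum (λ j → δ i j * t j) ≈ t i
  sum-δˡ i t = begin
    sum (λ j → δ i j * t j) ≈⟨ sum-single i _ (λ j j≢i → trans (*-congʳ (δ-≢ (j≢i ∘ ≡.sym))) (zeroˡ _)) ⟩
    δ i i * t i             ≈⟨ *-congʳ (δ-refl i) ⟩
    1# * t i                ≈⟨ *-identityˡ _ ⟩
    t i                     ∎

  sum-δʳ : ∀ {n} i (t : Vector A n) → sum (λ j → t j * δ j i) ≈ t i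
  sum-δʳ i t = begin
    sum (λ j → t j * δ j i) ≈⟨ sum-single i _ (λ j j≢i → trans (*-congˡ (δ-≢ j≢i)) (zeroʳ _)) ⟩
    t i * δ i i             ≈⟨ *-congˡ (δ-refl i) ⟩
    t i * 1#                ≈⟨ *-identityʳ _ ⟩
    t i                     ∎

  sum-↑ : ∀ a {b} (t : Vector A (a ℕ.+ b)) →
          sum t ≈ sum (t ∘ (_↑ˡ b)) + sum (t ∘ (a ↑ʳ_))
  sum-↑ zero    t = sym (+-identityˡ _)
  sum-↑ (suc a) t = trans (+-congˡ (sum-↑ a (t ∘ suc))) (sym (+-assoc _ _ _))

  sum-linear : ∀ {n} x (f g : Vector A n) →
               sum (λ i → x * f i + g i) ≈ x * sum f + sum g
  sum-linear x f g = trans (∑-distrib-+ (λ i → x * f i) g) (+-congʳ (sym (*-distribˡ-sum x f)))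

  -- The pattern of a Laplace expansion with two equal neighbouring columns: two terms cancel and
  -- all others vanish.
  sum-adjacent : ∀ {n} {i j : Fin n} (t : Vector A n) → Adjacent i j →
                 t i + t j ≈ 0# → (∀ l → l ≢ i → l ≢ j → t l ≈ 0#) → sum t ≈ 0#
  sum-adjacent t here tᵢ+tⱼ≈0 t≈0 = begin
    t zero + (t (suc zero) + _) ≈⟨ +-assoc _ _ _ ⟨
    (t zero + t (suc zero)) + _ ≈⟨ +-cong tᵢ+tⱼ≈0 (sum-zero λ l → t≈0 (suc (suc l)) (λ ()) (λ ())) ⟩
    0# + 0#                     ≈⟨ +-identityˡ _ ⟩
    0#                          ∎
  sum-adjacent t (there i~j) tᵢ+tⱼ≈0 t≈0 =
    trans (+-cong (t≈0 zero (λ ()) (λ ()))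
                  (sum-adjacent (t ∘ suc) i~j tᵢ+tⱼ≈0 λ l l≢i l≢j →
                    t≈0 (suc l) (l≢i ∘ suc-injective) (l≢j ∘ suc-injective)))
          (+-identityˡ _)

  -- The Laplace expansion as an alternating form in the columns

  det-cong : ∀ {n} {M N : Matrix A n} → M ≋ N → ∣ M ∣ ≈ ∣ N ∣
  det-cong {zero}  M≋N = refl
  det-cong {suc n} M≋N = sum-cong-≋ λ j → *-congˡ {sign j}
    (*-cong (M≋N zero j) (det-cong λ a b → M≋N (suc a) (punchIn j b)))

  -- Columns are treated before rows because the expansion along the first row handles them
  -- uniformly: in each term, column `k` enters either through the entry of the first row or through
  -- the minor, never through both.
  det-linear-column : ∀ {n} (k : Fin n) x (P M N : Matrix A n) →
    (∀ i j → j ≢ k → P i j ≈ M i j) → (∀ i j → j ≢ k → N i j ≈ M i j) →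
    (∀ i → P i k ≈ x * M i k + N i k) → ∣ P ∣ ≈ x * ∣ M ∣ + ∣ N ∣
  det-linear-column {suc n} k x P M N P≈M N≈M Pₖ = begin
    sum (term P)                              ≈⟨ sum-cong-≋ step ⟩
    sum (λ l → x * term M l + term N l)       ≈⟨ sum-linear x (term M) (term N) ⟩
    x * sum (term M) + sum (term N)           ∎
    where
    term : Matrix A (suc n) → Fin (suc n) → A
    term Q l = sign l * (Q zero l * ∣ minor l Q ∣)
    step : ∀ l → term P l ≈ x * term M l + term N l
    step l with l ≟ k
    ... | yes ≡.refl = begin
      sign l * (P zero l * ∣ minor l P ∣)
        ≈⟨ *-congˡ (*-cong (Pₖ zero) (det-cong λ a b → P≈M _ _ (punchInᵢ≢i l b))) ⟩
      sign l * ((x * M zero l + N zero l) * ∣ minor l M ∣)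
        ≈⟨ solve 5 (λ s x m n d → s :* ((x :* m :+ n) :* d) := x :* (s :* (m :* d)) :+ s :* (n :* d)) refl
             (sign l) x (M zero l) (N zero l) ∣ minor l M ∣ ⟩
      x * term M l + sign l * (N zero l * ∣ minor l M ∣)
        ≈⟨ +-congˡ (*-congˡ (*-congˡ (det-cong λ a b → N≈M _ _ (punchInᵢ≢i l b)))) ⟨
      x * term M l + term N l ∎
    ... | no l≢k = begin
      sign l * (P zero l * ∣ minor l P ∣)
        ≈⟨ *-congˡ (*-cong (P≈M _ _ l≢k) (det-linear-column (punchOut l≢k) x (minor l P) (minor l M) (minor l N)
             (λ i j j≢ → P≈M _ _ (off j≢)) (λ i j j≢ → N≈M _ _ (off j≢)) λ i → at i)) ⟩
      sign l * (M zero l * (x * ∣ minor l M ∣ + ∣ minor l N ∣))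
        ≈⟨ solve 5 (λ s x m d e → s :* (m :* (x :* d :+ e)) := x :* (s :* (m :* d)) :+ s :* (m :* e)) refl
             (sign l) x (M zero l) ∣ minor l M ∣ ∣ minor l N ∣ ⟩
      x * term M l + sign l * (M zero l * ∣ minor l N ∣)
        ≈⟨ +-congˡ (*-congˡ (*-congʳ (N≈M _ _ l≢k))) ⟨
      x * term M l + term N l ∎
      where
      off : ∀ {j} → j ≢ punchOut l≢k → punchIn l j ≢ k
      off {j} j≢ eq = j≢ (punchIn-injective l j _ (≡.trans eq (≡.sym (punchIn-punchOut l≢k))))
      at : ∀ i → minor l P i (punchOut l≢k) ≈ x * minor l M i (punchOut l≢k) + minor l N i (punchOut l≢k)
      at i rewrite punchIn-punchOut l≢k = Pₖ (suc i)

  sign-adjacent : ∀ {n} {i j : Fin n} → Adjacent i j → sign j ≈ - sign i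
  sign-adjacent here = *-identityʳ _
  sign-adjacent (there {i = i} i~j) = trans (*-congˡ (sign-adjacent i~j)) (sym (-‿distribʳ-* (- 1#) (sign i)))

  -- The terms of the two equal columns have equal minors and opposite signs; every other minor
  -- still contains both columns side by side and vanishes by induction.
  det-alternating-column : ∀ {n} {i j : Fin n} → Adjacent i j → (M : Matrix A n) →
                           (∀ r → M r i ≈ M r j) → ∣ M ∣ ≈ 0#
  det-alternating-column {suc n} {i} {j} i~j M Mᵢ≈Mⱼ = sum-adjacent _ i~j cancel vanish
    where
    minors : minor i M ≋ minor j M
    minors a b with Adjacent-punchIn i~j b
    ... | inj₁ eq         = reflexive (≡.cong (M (suc a)) eq)
    ... | inj₂ (eq , eq′) = begin
      M (suc a) (punchIn i b) ≡⟨ ≡.cong (M (suc a)) eq ⟩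
      M (suc a) j             ≈⟨ Mᵢ≈Mⱼ (suc a) ⟨
      M (suc a) i             ≡⟨ ≡.cong (M (suc a)) eq′ ⟨
      M (suc a) (punchIn j b) ∎
    cancel : sign i * (M zero i * ∣ minor i M ∣) + sign j * (M zero j * ∣ minor j M ∣) ≈ 0#
    cancel = begin
      sign i * (M zero i * ∣ minor i M ∣) + sign j * (M zero j * ∣ minor j M ∣)
        ≈⟨ +-congʳ (*-congˡ (*-cong (Mᵢ≈Mⱼ zero) (det-cong minors))) ⟩
      sign i * t + sign j * t   ≈⟨ +-congˡ (*-congʳ (sign-adjacent i~j)) ⟩
      sign i * t + - sign i * t ≈⟨ distribʳ t _ _ ⟨
      (sign i + - sign i) * t   ≈⟨ *-congʳ (-‿inverseʳ _) ⟩
      0# * t                    ≈⟨ zeroˡ t ⟩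
      0#                        ∎
      where t = M zero j * ∣ minor j M ∣
    vanish : ∀ l → l ≢ i → l ≢ j → sign l * (M zero l * ∣ minor l M ∣) ≈ 0#
    vanish l l≢i l≢j with _ , _ , i′~j′ , eqᵢ , eqⱼ ← Adjacent-punchOut i~j l l≢i l≢j = begin
      sign l * (M zero l * ∣ minor l M ∣) ≈⟨ *-congˡ (*-congˡ (det-alternating-column i′~j′ (minor l M) λ r → begin
        M (suc r) _ ≡⟨ ≡.cong (M (suc r)) eqᵢ ⟩
        M (suc r) i ≈⟨ Mᵢ≈Mⱼ (suc r) ⟩
        M (suc r) j ≡⟨ ≡.cong (M (suc r)) eqⱼ ⟨
        M (suc r) _ ∎)) ⟩
      sign l * (M zero l * 0#) ≈⟨ *-congˡ (zeroʳ _) ⟩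
      sign l * 0#              ≈⟨ zeroʳ _ ⟩
      0#                       ∎

  -- Alternating forms in the rows and their uniqueness

  record IsAlternating {m n} (f : (Fin m → Fin n → A) → A) : Set (c ⊔ ℓ) where
    field
      cong   : ∀ {M N} → M ≋ N → f M ≈ f N
      linear : ∀ i x (P M N : Fin m → Fin n → A) →
               (∀ k → k ≢ i → ∀ j → P k j ≈ M k j) → (∀ k → k ≢ i → ∀ j → N k j ≈ M k j) →
               (∀ j → P i j ≈ x * M i j + N i j) → f P ≈ x * f M + f N
      alternating : ∀ {i j} → Adjacent i j → ∀ M → (∀ k → M i k ≈ M j k) → f M ≈ 0#

  open IsAlternating

  det-transpose-isAlternating : ∀ {n} → IsAlternating {n} {n} (λ M → ∣ (λ i j → M j i) ∣)
  det-transpose-isAlternating = record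
    { cong        = λ M≋N → det-cong λ i j → M≋N j i
    ; linear      = λ k x P M N P≈M N≈M Pₖ →
        det-linear-column k x _ _ _ (λ i j j≢k → P≈M j j≢k i) (λ i j j≢k → N≈M j j≢k i) Pₖ
    ; alternating = λ i~j M → det-alternating-column i~j (λ i j → M j i)
    }

  ∷-cong : ∀ {m n} {v w : Fin n → A} {M N : Fin m → Fin n → A} →
           (∀ j → v j ≈ w j) → M ≋ N → (v ∷ᵛ M) ≋ (w ∷ᵛ N)
  ∷-cong v≈w M≋N zero    = v≈w
  ∷-cong v≈w M≋N (suc i) = M≋N i

  head∷tail : ∀ {m n} (M : Fin (suc m) → Fin n → A) → M ≋ (M zero ∷ᵛ (M ∘ suc))
  head∷tail M zero    j = refl
  head∷tail M (suc i) j = refl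

  ∷-isAlternating : ∀ {m n} {f : (Fin (suc m) → Fin n → A) → A} → IsAlternating f →
                    ∀ v → IsAlternating (λ M → f (v ∷ᵛ M))
  ∷-isAlternating F v = record
    { cong        = λ M≋N → cong F (∷-cong (λ _ → refl) M≋N)
    ; linear      = λ i x P M N P≈M N≈M Pᵢ → linear F (suc i) x _ _ _
        (λ { zero _ j → refl ; (suc k) k≢i → P≈M k (k≢i ∘ ≡.cong suc) })
        (λ { zero _ j → refl ; (suc k) k≢i → N≈M k (k≢i ∘ ≡.cong suc) }) Pᵢ
    ; alternating = λ i~j M → alternating F (there i~j) (v ∷ᵛ M)
    }

  module _ {m n : ℕ} {f : (Fin (suc m) → Fin n → A) → A} (F : IsAlternating f) where

    linear-head : ∀ x {u v w : Fin n → A} T → (∀ j → u j ≈ x * v j + w j) →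
                  f (u ∷ᵛ T) ≈ x * f (v ∷ᵛ T) + f (w ∷ᵛ T)
    linear-head x T = linear F zero x _ _ _
      (λ { zero 0≢0 → contradiction ≡.refl 0≢0 ; (suc k) _ j → refl })
      (λ { zero 0≢0 → contradiction ≡.refl 0≢0 ; (suc k) _ j → refl })

    -- The row is written as -1 times itself plus itself, so that by linearity the value cancels
    -- against its own negative.
    zero-head : ∀ {u : Fin n → A} T → (∀ j → u j ≈ 0#) → f (u ∷ᵛ T) ≈ 0#
    zero-head {u} T u≈0 = begin
      f (u ∷ᵛ T)                          ≈⟨ linear-head (- 1#) T (λ j → begin
        u j              ≈⟨ u≈0 j ⟩
        0#               ≈⟨ -‿inverseˡ (u j) ⟨
        - u j + u j      ≈⟨ +-congʳ (-1*x≈-x (u j)) ⟨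
        - 1# * u j + u j ∎) ⟩
      - 1# * f (u ∷ᵛ T) + f (u ∷ᵛ T)      ≈⟨ +-congʳ (-1*x≈-x _) ⟩
      - f (u ∷ᵛ T) + f (u ∷ᵛ T)           ≈⟨ -‿inverseˡ _ ⟩
      0#                                  ∎

    sum-head : ∀ {q} (x : Vector A q) (v : Fin q → Fin n → A) T →
               f ((λ k → sum λ j → x j * v j k) ∷ᵛ T) ≈ sum (λ j → x j * f (v j ∷ᵛ T))
    sum-head {zero}  x v T = zero-head T λ _ → refl
    sum-head {suc q} x v T = trans (linear-head (x zero) T λ _ → refl) (+-congˡ (sum-head (x ∘ suc) (v ∘ suc) T))

  -- Polarization: expanding the form at two equal rows `u+v` leaves just the two mixed terms.
  swap : ∀ {m n} {f : (Fin (suc (suc m)) → Fin n → A) → A} → IsAlternating f →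
         ∀ u v T → f (u ∷ᵛ v ∷ᵛ T) ≈ - f (v ∷ᵛ u ∷ᵛ T)
  swap {f = f} F u v T = +-inverseˡ-unique _ _ (begin
    f (u ∷ᵛ v ∷ᵛ T) + f (v ∷ᵛ u ∷ᵛ T)      ≈⟨ +-cong (trans (linear₁ u) (trans (+-congʳ (equal u)) (+-identityˡ _)))
                                                     (trans (linear₁ v) (trans (+-congˡ (equal v)) (+-identityʳ _))) ⟨
    f (u ∷ᵛ u+v ∷ᵛ T) + f (v ∷ᵛ u+v ∷ᵛ T)  ≈⟨ linear₀ F (u+v ∷ᵛ T) ⟨
    f (u+v ∷ᵛ u+v ∷ᵛ T)                    ≈⟨ equal u+v ⟩
    0#                                     ∎)
    where
    u+v = λ j → u j + v j
    equal : ∀ w → f (w ∷ᵛ w ∷ᵛ T) ≈ 0#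
    equal w = alternating F here _ λ _ → refl
    linear₀ : ∀ {m} {g : (Fin (suc m) → _ → A) → A} → IsAlternating g →
              ∀ S → g (u+v ∷ᵛ S) ≈ g (u ∷ᵛ S) + g (v ∷ᵛ S)
    linear₀ G S = trans (linear-head G 1# S λ j → +-congʳ (sym (*-identityˡ _))) (+-congʳ (*-identityˡ _))
    linear₁ : ∀ w → f (w ∷ᵛ u+v ∷ᵛ T) ≈ f (w ∷ᵛ u ∷ᵛ T) + f (w ∷ᵛ v ∷ᵛ T)
    linear₁ w = linear₀ (∷-isAlternating F w) T

  shear : ∀ {m n} {f : (Fin (suc m) → Fin n → A) → A} → IsAlternating f →
          ∀ v T (x : Vector A m) → f (v ∷ᵛ (λ i j → x i * v j + T i j)) ≈ f (v ∷ᵛ T)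
  shear {zero} F v T x = cong F (∷-cong (λ _ → refl) λ ())
  shear {suc m} {f = f} F v T x = begin
    f (v ∷ᵛ T′)                       ≈⟨ cong F (∷-cong (λ _ → refl) (head∷tail T′)) ⟩
    f (v ∷ᵛ T′ zero ∷ᵛ T′ ∘ suc)      ≈⟨ linear-head (∷-isAlternating F v) (x zero) _ (λ _ → refl) ⟩
    x zero * f (v ∷ᵛ v ∷ᵛ T′ ∘ suc) + f (v ∷ᵛ T zero ∷ᵛ T′ ∘ suc)
      ≈⟨ +-congʳ (trans (*-congˡ (alternating F here _ λ _ → refl)) (zeroʳ _)) ⟩
    0# + f (v ∷ᵛ T zero ∷ᵛ T′ ∘ suc)  ≈⟨ +-identityˡ _ ⟩
    -- The row `T zero` is finished; `v` moves past it so that it again stands directly above the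
    -- rows still to be sheared.
    f (v ∷ᵛ T zero ∷ᵛ T′ ∘ suc)       ≈⟨ swap F _ _ _ ⟩
    - f (T zero ∷ᵛ v ∷ᵛ T′ ∘ suc)     ≈⟨ -‿cong (shear (∷-isAlternating F (T zero)) v (T ∘ suc) (x ∘ suc)) ⟩
    - f (T zero ∷ᵛ v ∷ᵛ T ∘ suc)      ≈⟨ swap F _ _ _ ⟨
    f (v ∷ᵛ T zero ∷ᵛ T ∘ suc)        ≈⟨ cong F (∷-cong (λ _ → refl) (head∷tail T)) ⟨
    f (v ∷ᵛ T)                        ∎
    where T′ = λ i j → x i * v j + T i j

  -- Row `j` passes the `j` rows above it by one swap each, which produces exactly the sign of the
  -- Laplace expansion.
  move-to-front : ∀ {m n} {f : (Fin (suc m) → Fin n → A) → A} → IsAlternating f →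
                  ∀ j T → f (T j ∷ᵛ (T ∘ punchIn j)) ≈ sign j * f T
  move-to-front F zero T = trans (cong F λ { zero k → refl ; (suc i) k → refl }) (sym (*-identityˡ _))
  move-to-front {suc m} {f = f} F (suc j) T = begin
    f (T (suc j) ∷ᵛ (T ∘ punchIn (suc j)))              ≈⟨ cong F (∷-cong (λ _ → refl) (head∷tail (T ∘ punchIn (suc j)))) ⟩
    f (T (suc j) ∷ᵛ T zero ∷ᵛ (T ∘ suc ∘ punchIn j))    ≈⟨ swap F _ _ _ ⟩
    - f (T zero ∷ᵛ T (suc j) ∷ᵛ (T ∘ suc ∘ punchIn j))  ≈⟨ -‿cong (move-to-front (∷-isAlternating F (T zero)) j (T ∘ suc)) ⟩
    - (sign j * f (T zero ∷ᵛ T ∘ suc))                  ≈⟨ -1*x≈-x _ ⟨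
    - 1# * (sign j * f (T zero ∷ᵛ T ∘ suc))             ≈⟨ *-assoc _ _ _ ⟨
    - 1# * sign j * f (T zero ∷ᵛ T ∘ suc)               ≈⟨ *-congˡ (cong F (head∷tail T)) ⟨
    - 1# * sign j * f T                                 ∎

  -- The first row is swapped downwards until it meets its double.
  alternating-head : ∀ {m n} {f : (Fin (suc m) → Fin n → A) → A} → IsAlternating f →
                     ∀ i T → (∀ k → T zero k ≈ T (suc i) k) → f T ≈ 0#
  alternating-head F zero T T₀≈Tᵢ = alternating F here T T₀≈Tᵢ
  alternating-head {f = f} F (suc i) T T₀≈Tᵢ = begin
    f T ≈⟨ cong F (λ { zero k → refl ; (suc zero) k → refl ; (suc (suc i)) k → refl }) ⟩
    f (T zero ∷ᵛ T (suc zero) ∷ᵛ T″)   ≈⟨ swap F _ _ _ ⟩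
    - f (T (suc zero) ∷ᵛ T zero ∷ᵛ T″) ≈⟨ -‿cong (alternating-head (∷-isAlternating F (T (suc zero))) i _ T₀≈Tᵢ) ⟩
    - 0#                                          ≈⟨ -0#≈0# ⟩
    0#                                            ∎
    where
    T″ : Fin _ → Fin _ → A
    T″ k = T (suc (suc k))

  alternating-≢ : ∀ {m n} {f : (Fin m → Fin n → A) → A} → IsAlternating f →
                  ∀ i j → i ≢ j → ∀ T → (∀ k → T i k ≈ T j k) → f T ≈ 0#
  alternating-≢ F zero zero i≢j T Tᵢ≈Tⱼ = contradiction ≡.refl i≢j
  alternating-≢ F zero (suc j) i≢j T Tᵢ≈Tⱼ = alternating-head F j T Tᵢ≈Tⱼ
  alternating-≢ F (suc i) zero i≢j T Tᵢ≈Tⱼ = alternating-head F i T (sym ∘ Tᵢ≈Tⱼ)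
  alternating-≢ F (suc i) (suc j) i≢j T Tᵢ≈Tⱼ =
    trans (cong F (head∷tail T))
          (alternating-≢ (∷-isAlternating F (T zero)) i j (i≢j ∘ ≡.cong suc) (T ∘ suc) Tᵢ≈Tⱼ)

  -- Counterpart of deleting column `j` in a minor: a form in n + 1 columns, restricted to matrices
  -- whose column `j` is zero, becomes a form in n columns, to which induction applies.
  insertColumn : ∀ {m n} → Fin (suc n) → (Fin m → Fin n → A) → Fin m → Fin (suc n) → A
  insertColumn j M i = insertAt (M i) j 0#

  insertAt-elim : ∀ {p n} (j : Fin (suc n)) (P : Fin (suc n) → Set p) →
                  P j → (∀ k → P (punchIn j k)) → ∀ k → P k
  insertAt-elim j P Pⱼ P↑ k with punchIn-view j k
  ... | inj₁ ≡.refl       = Pⱼ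
  ... | inj₂ (k , ≡.refl) = P↑ k

  insertAt-cong : ∀ {n} j {u v : Vector A n} → (∀ k → u k ≈ v k) →
                  ∀ k → insertAt u j 0# k ≈ insertAt v j 0# k
  insertAt-cong j {u} {v} u≈v = insertAt-elim j _
    (reflexive (≡.trans (insertAt-lookup u j 0#) (≡.sym (insertAt-lookup v j 0#))))
    λ k → trans (reflexive (insertAt-punchIn u j 0# k))
                (trans (u≈v k) (reflexive (≡.sym (insertAt-punchIn v j 0# k))))

  insertAt-linear : ∀ {n} j x {u v w : Vector A n} → (∀ k → u k ≈ x * v k + w k) →
                    ∀ k → insertAt u j 0# k ≈ x * insertAt v j 0# k + insertAt w j 0# k
  insertAt-linear j x {u} {v} {w} u≈ = insertAt-elim j _ at (λ k → off k)
    where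
    at : insertAt u j 0# j ≈ x * insertAt v j 0# j + insertAt w j 0# j
    at rewrite insertAt-lookup u j 0# | insertAt-lookup v j 0# | insertAt-lookup w j 0# =
      sym (trans (+-congʳ (zeroʳ x)) (+-identityˡ _))
    off : ∀ k → insertAt u j 0# (punchIn j k) ≈ x * insertAt v j 0# (punchIn j k) + insertAt w j 0# (punchIn j k)
    off k rewrite insertAt-punchIn u j 0# k | insertAt-punchIn v j 0# k | insertAt-punchIn w j 0# k = u≈ k

  insertColumn-isAlternating : ∀ {m n} {f : (Fin m → Fin (suc n) → A) → A} → IsAlternating f →
                               ∀ j → IsAlternating (λ M → f (insertColumn j M))
  insertColumn-isAlternating F j = record
    { cong        = λ M≋N → cong F λ i → insertAt-cong j (M≋N i)
    ; linear      = λ i x P M N P≈M N≈M Pᵢ → linear F i x _ _ _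
        (λ k k≢i → insertAt-cong j (P≈M k k≢i)) (λ k k≢i → insertAt-cong j (N≈M k k≢i))
        (insertAt-linear j x Pᵢ)
    ; alternating = λ i~j M Mᵢ≈Mⱼ → alternating F i~j _ (insertAt-cong j Mᵢ≈Mⱼ)
    }

  -- Both sides are alternating forms in the rows, so it suffices to expand the
  -- first row in the standard basis and to clear the column of its pivot.
  alternating-unique : ∀ {n} {f : Matrix A n → A} → IsAlternating f →
                       ∀ M → f M ≈ ∣ M ∣ * f δ
  alternating-unique {zero} F M = trans (cong F λ ()) (sym (*-identityˡ _))
  alternating-unique {suc n} {f} F M = begin
    f M ≈⟨ cong F (head∷tail M) ⟩
    f (M zero ∷ᵛ M ∘ suc)
      ≈⟨ cong F (∷-cong (λ k → sum-δʳ k (M zero)) (λ _ _ → refl)) ⟨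
    f ((λ k → sum λ j → M zero j * δ j k) ∷ᵛ M ∘ suc)
      ≈⟨ sum-head F (M zero) δ (M ∘ suc) ⟩
    sum (λ j → M zero j * f (δ j ∷ᵛ M ∘ suc))
      ≈⟨ sum-cong-≋ (λ j → trans (*-congˡ (pivot j))
           (solve 4 (λ m s d e → m :* (d :* (s :* e)) := s :* (m :* d) :* e) refl
             (M zero j) (sign j) ∣ minor j M ∣ (f δ))) ⟩
    sum (λ j → sign j * (M zero j * ∣ minor j M ∣) * f δ)
      ≈⟨ *-distribʳ-sum (f δ) (λ j → sign j * (M zero j * ∣ minor j M ∣)) ⟨
    ∣ M ∣ * f δ ∎
    where
    clear : ∀ j i k → insertColumn j (minor j M) i k ≈ - M (suc i) j * δ j k + M (suc i) k
    clear j i = insertAt-elim j _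
      (begin
        insertColumn j (minor j M) i j     ≡⟨ insertAt-lookup (minor j M i) j 0# ⟩
        0#                                 ≈⟨ -‿inverseˡ _ ⟨
        - M (suc i) j + M (suc i) j        ≈⟨ +-congʳ (trans (*-congˡ (δ-refl j)) (*-identityʳ _)) ⟨
        - M (suc i) j * δ j j + M (suc i) j ∎)
      (λ k → begin
        insertColumn j (minor j M) i (punchIn j k) ≡⟨ insertAt-punchIn (minor j M i) j 0# k ⟩
        M (suc i) (punchIn j k)                    ≈⟨ +-identityˡ _ ⟨
        0# + M (suc i) (punchIn j k)               ≈⟨ +-congʳ (trans (*-congˡ (δ-≢ (punchInᵢ≢i j k ∘ ≡.sym))) (zeroʳ _)) ⟨
        - M (suc i) j * δ j (punchIn j k) + M (suc i) (punchIn j k) ∎)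
    basis : ∀ j i k → insertColumn j δ i k ≈ δ (punchIn j i) k
    basis j i = insertAt-elim j _
      (trans (reflexive (insertAt-lookup (δ i) j 0#)) (sym (δ-≢ (punchInᵢ≢i j i))))
      (λ k → trans (reflexive (insertAt-punchIn (δ i) j 0# k))
                   (sym (δ-injective {f = punchIn j} (punchIn-injective j _ _) i k)))
    pivot : ∀ j → f (δ j ∷ᵛ M ∘ suc) ≈ ∣ minor j M ∣ * (sign j * f δ)
    pivot j = begin
      f (δ j ∷ᵛ M ∘ suc)
        ≈⟨ shear F (δ j) (M ∘ suc) (λ i → - M (suc i) j) ⟨
      f (δ j ∷ᵛ (λ i k → - M (suc i) j * δ j k + M (suc i) k))
        ≈⟨ cong F (∷-cong (λ _ → refl) (clear j)) ⟨
      f (δ j ∷ᵛ insertColumn j (minor j M))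
        ≈⟨ alternating-unique (insertColumn-isAlternating (∷-isAlternating F (δ j)) j) (minor j M) ⟩
      ∣ minor j M ∣ * f (δ j ∷ᵛ insertColumn j δ)
        ≈⟨ *-congˡ (cong F (∷-cong (λ _ → refl) (basis j))) ⟩
      -- What remains is the identity matrix with row `j` moved to the front, the source of the
      -- Laplace sign.
      ∣ minor j M ∣ * f (δ j ∷ᵛ δ ∘ punchIn j)
        ≈⟨ *-congˡ (move-to-front F j δ) ⟩
      ∣ minor j M ∣ * (sign j * f δ) ∎

  -- Block triangular matrices, transposes, products and relabelling

  -- In the expansion along the first row the right columns contribute nothing, and deleting a left
  -- column leaves the upper right block zero and the lower right block unchanged.
  det-lower-triangular : ∀ a {b} (M : Matrix A (a ℕ.+ b)) →
    (∀ i y → M (i ↑ˡ b) (a ↑ʳ y) ≈ 0#) →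
    ∣ M ∣ ≈ ∣ (λ i j → M (i ↑ˡ b) (j ↑ˡ b)) ∣ * ∣ (λ y z → M (a ↑ʳ y) (a ↑ʳ z)) ∣
  det-lower-triangular zero M M≈0 = sym (*-identityˡ _)
  det-lower-triangular (suc a) {b} M M≈0 = begin
    sum t                                              ≈⟨ sum-↑ (suc a) t ⟩
    sum (t ∘ (_↑ˡ b)) + sum (t ∘ (suc a ↑ʳ_))          ≈⟨ +-congˡ (sum-zero λ y →
      trans (*-congˡ (trans (*-congʳ (M≈0 zero y)) (zeroˡ _))) (zeroʳ _)) ⟩
    sum (t ∘ (_↑ˡ b)) + 0#                             ≈⟨ +-identityʳ _ ⟩
    sum (t ∘ (_↑ˡ b))                                  ≈⟨ sum-cong-≋ step ⟩
    sum (λ j → u j * d)                                ≈⟨ *-distribʳ-sum d u ⟨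
    sum u * d ∎
    where
    B = λ i j → M (i ↑ˡ b) (j ↑ˡ b)
    d = ∣ (λ y z → M (suc a ↑ʳ y) (suc a ↑ʳ z)) ∣
    t = λ j → sign j * (M zero j * ∣ minor j M ∣)
    u = λ j → sign j * (B zero j * ∣ minor j B ∣)
    step : ∀ j → t (j ↑ˡ b) ≈ u j * d
    step j = begin
      sign (j ↑ˡ b) * (M zero (j ↑ˡ b) * ∣ minor (j ↑ˡ b) M ∣)
        ≈⟨ *-cong (reflexive (≡.cong ((- 1#) ^_) (toℕ-↑ˡ j b))) (*-congˡ (begin
             ∣ minor (j ↑ˡ b) M ∣
               ≈⟨ det-lower-triangular a (minor (j ↑ˡ b) M) (λ i y →
                    trans (reflexive (≡.cong (M _) (punchIn-↑ʳ j y))) (M≈0 (suc i) y)) ⟩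
             ∣ (λ i k → minor (j ↑ˡ b) M (i ↑ˡ b) (k ↑ˡ b)) ∣ * ∣ (λ y z → minor (j ↑ˡ b) M (a ↑ʳ y) (a ↑ʳ z)) ∣
               ≈⟨ *-cong (det-cong λ i k → reflexive (≡.cong (M _) (punchIn-↑ˡ b j k)))
                         (det-cong λ y z → reflexive (≡.cong (M _) (punchIn-↑ʳ j z))) ⟩
             ∣ minor j B ∣ * d ∎)) ⟩
      sign j * (B zero j * (∣ minor j B ∣ * d))
        ≈⟨ solve 4 (λ s m e d → s :* (m :* (e :* d)) := s :* (m :* e) :* d) refl _ _ _ d ⟩
      u j * d ∎

  det-scalar : ∀ n x → ∣ (λ (i j : Fin n) → x * δ i j) ∣ ≈ x ^ n
  det-scalar zero    x = refl
  det-scalar (suc n) x = begin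
    ∣ xδ ∣                                       ≈⟨ det-lower-triangular 1 xδ (λ { zero y → zeroʳ x }) ⟩
    (1# * (x * 1# * 1#) + 0#) * ∣ (λ y z → xδ (suc y) (suc z)) ∣
      ≈⟨ *-cong (solve 1 (λ x → con 1 :* (x :* con 1 :* con 1) :+ con 0 := x) refl x)
                (det-cong {n} λ i j → *-congˡ {x} (δ-injective suc-injective i j)) ⟩
    x * ∣ (λ (i j : Fin n) → x * δ i j) ∣        ≈⟨ *-congˡ (det-scalar n x) ⟩
    x * x ^ n                                    ∎
    where xδ = λ (i j : Fin (suc n)) → x * δ i j

  1^ : ∀ n → 1# ^ n ≈ 1#
  1^ zero    = refl
  1^ (suc n) = trans (*-identityˡ _) (1^ n)

  det-δ : ∀ n → ∣ δ {n} ∣ ≈ 1#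
  det-δ n = trans (trans (det-cong {n} λ i j → sym (*-identityˡ _)) (det-scalar n 1#)) (1^ n)

  -- The column properties say that the determinant of the transpose is an alternating form in the
  -- rows; by uniqueness it is the determinant times its value 1 at the identity. The row properties
  -- of the determinant itself follow from this.
  det-transpose : ∀ {n} (M : Matrix A n) → ∣ (λ i j → M j i) ∣ ≈ ∣ M ∣
  det-transpose {n} M = begin
    ∣ (λ i j → M j i) ∣          ≈⟨ alternating-unique det-transpose-isAlternating M ⟩
    ∣ M ∣ * ∣ (λ (i j : Fin n) → δ j i) ∣  ≈⟨ *-congˡ (trans (det-cong {n} δ-sym) (det-δ n)) ⟩
    ∣ M ∣ * 1#                   ≈⟨ *-identityʳ _ ⟩
    ∣ M ∣                        ∎
    where
    δ-sym : ∀ (i j : Fin n) → δ j i ≈ δ i j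
    δ-sym i j with i ≟ j
    ... | yes ≡.refl = δ-refl i
    ... | no i≢j     = δ-≢ (i≢j ∘ ≡.sym)

  det-isAlternating : ∀ {n} → IsAlternating {n} {n} ∣_∣
  det-isAlternating = record
    { cong        = det-cong
    ; linear      = λ i x P M N P≈M N≈M Pᵢ → trans (sym (det-transpose P)) (trans
        (linear det-transpose-isAlternating i x P M N P≈M N≈M Pᵢ)
        (+-cong (*-congˡ (det-transpose M)) (det-transpose N)))
    ; alternating = λ i~j M Mᵢ≈Mⱼ → trans (sym (det-transpose M))
        (alternating det-transpose-isAlternating i~j M Mᵢ≈Mⱼ)
    }

  -- For fixed `N` the left side is an alternating form in the rows of `M`, with value `∣ N ∣` at
  -- the identity.
  det-⊛ : ∀ {n} (M N : Matrix A n) → ∣ M ⊛ N ∣ ≈ ∣ M ∣ * ∣ N ∣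
  det-⊛ {n} M N = trans (alternating-unique ⊛-isAlternating M)
    (*-congˡ (det-cong λ i k → sum-δˡ i (λ j → N j k)))
    where
    row-cong : ∀ {u v : Vector A n} → (∀ k → u k ≈ v k) →
               ∀ k → sum (λ l → u l * N l k) ≈ sum (λ l → v l * N l k)
    row-cong u≈v k = sum-cong-≋ λ l → *-congʳ (u≈v l)
    ⊛-isAlternating : IsAlternating (λ M → ∣ M ⊛ N ∣)
    ⊛-isAlternating = record
      { cong        = λ M≋M′ → det-cong λ i → row-cong (M≋M′ i)
      ; linear      = λ i x P M Q P≈M Q≈M Pᵢ → linear det-isAlternating i x _ _ _
          (λ k k≢i → row-cong (P≈M k k≢i)) (λ k k≢i → row-cong (Q≈M k k≢i))
          λ j → trans (sum-cong-≋ λ l → trans (*-congʳ (Pᵢ l))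
                        (solve 4 (λ x m q n → (x :* m :+ q) :* n := x :* (m :* n) :+ q :* n) refl x (M i l) (Q i l) (N l j)))
                      (sum-linear x (λ l → M i l * N l j) (λ l → Q i l * N l j))
      ; alternating = λ i~j M Mᵢ≈Mⱼ → alternating det-isAlternating i~j _ (row-cong Mᵢ≈Mⱼ)
      }

  -- Relabelling rows and columns alike fixes `δ`, so uniqueness applies and no sign of a
  -- permutation has to be computed. Neighbouring rows may end up far apart, hence the appeal to
  -- `alternating-≢`.
  det-permute : ∀ {n} (π : Permutation′ n) (M : Matrix A n) →
                ∣ (λ i j → M (π ⟨$⟩ʳ i) (π ⟨$⟩ʳ j)) ∣ ≈ ∣ M ∣
  det-permute {n} π M = trans (alternating-unique permute-isAlternating M)
    (trans (*-congˡ (trans (det-cong {n} (δ-injective (⟨$⟩ʳ-injective π))) (det-δ n))) (*-identityʳ _))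
    where
    ⟨$⟩ʳ-injective : ∀ {n} (π : Permutation′ n) {i j} → π ⟨$⟩ʳ i ≡ π ⟨$⟩ʳ j → i ≡ j
    ⟨$⟩ʳ-injective π eq = ≡.trans (≡.sym (Perm.inverseˡ π)) (≡.trans (≡.cong (π ⟨$⟩ˡ_) eq) (Perm.inverseˡ π))
    permute : ∀ {n} → Permutation′ n → Matrix A n → Matrix A n
    permute π M i j = M (π ⟨$⟩ʳ i) (π ⟨$⟩ʳ j)
    off : ∀ {i k} → k ≢ π ⟨$⟩ˡ i → π ⟨$⟩ʳ k ≢ i
    off k≢ eq = k≢ (≡.trans (≡.sym (Perm.inverseˡ π)) (≡.cong (π ⟨$⟩ˡ_) eq))
    permute-isAlternating : IsAlternating (λ M → ∣ permute π M ∣)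
    permute-isAlternating = record
      { cong        = λ M≋N → det-cong λ i j → M≋N (π ⟨$⟩ʳ i) (π ⟨$⟩ʳ j)
      ; linear      = λ i x P M N P≈M N≈M Pᵢ → linear det-isAlternating (π ⟨$⟩ˡ i) x _ _ _
          (λ k k≢ j → P≈M _ (off k≢) _) (λ k k≢ j → N≈M _ (off k≢) _)
          λ j → ≡.subst (λ i → P i (π ⟨$⟩ʳ j) ≈ x * M i (π ⟨$⟩ʳ j) + N i (π ⟨$⟩ʳ j))
                  (≡.sym (Perm.inverseʳ π)) (Pᵢ _)
      ; alternating = λ {i} {j} i~j M Mᵢ≈Mⱼ → alternating-≢ det-isAlternating (π ⟨$⟩ˡ i) (π ⟨$⟩ˡ j)
          (λ eq → Adjacent⇒≢ i~j (⟨$⟩ʳ-injective (Perm.flip π) eq)) _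
          λ k → ≡.subst₂ (λ i j → M i (π ⟨$⟩ʳ k) ≈ M j (π ⟨$⟩ʳ k))
                  (≡.sym (Perm.inverseʳ π)) (≡.sym (Perm.inverseʳ π)) (Mᵢ≈Mⱼ _)
      }

  -- Schur complements without division, block diagonal matrices

  module _ (a : ℕ) {b : ℕ} (M : Matrix A (a ℕ.+ b)) (x : A) (β : Fin a → Fin b → A) where

    -- Write `M` in blocks A, B, C, D. If D is invertible and xB + βD = 0, then β = -xBD⁻¹ and this
    -- matrix is x(A - BD⁻¹C), the usual Schur complement scaled by `x`.
    schurComplement : Matrix A a
    schurComplement i j = x * M (i ↑ˡ b) (j ↑ˡ b) + sum λ y → β i y * M (a ↑ʳ y) (j ↑ˡ b)

    -- Multiplying on the left by [[x, β], [0, 1]] clears the upper right block.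
    det-schurComplement :
      (∀ i z → x * M (i ↑ˡ b) (a ↑ʳ z) + sum (λ y → β i y * M (a ↑ʳ y) (a ↑ʳ z)) ≈ 0#) →
      x ^ a * ∣ M ∣ ≈ ∣ schurComplement ∣ * ∣ (λ y z → M (a ↑ʳ y) (a ↑ʳ z)) ∣
    det-schurComplement vanish = begin
      x ^ a * ∣ M ∣      ≈⟨ *-congʳ det-E ⟨
      ∣ E ∣ * ∣ M ∣      ≈⟨ det-⊛ E M ⟨
      ∣ E ⊛ M ∣          ≈⟨ det-lower-triangular a (E ⊛ M) (λ i z → trans (upper i _) (vanish i z)) ⟩
      ∣ (λ i j → (E ⊛ M) (i ↑ˡ b) (j ↑ˡ b)) ∣ * ∣ (λ y z → (E ⊛ M) (a ↑ʳ y) (a ↑ʳ z)) ∣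
        ≈⟨ *-cong (det-cong λ i j → upper i _) (det-cong λ y z → lower y _) ⟩
      ∣ schurComplement ∣ * ∣ (λ y z → M (a ↑ʳ y) (a ↑ʳ z)) ∣ ∎
      where
      E : Matrix A (a ℕ.+ b)
      E k l = [ (λ i → [ (λ j → x * δ i j) , β i ]′ (splitAt a l))
              , (λ y → [ (λ _ → 0#) , δ y ]′ (splitAt a l)) ]′ (splitAt a k)

      Eˡˡ : ∀ i j → E (i ↑ˡ b) (j ↑ˡ b) ≡ x * δ i j
      Eˡˡ i j rewrite splitAt-↑ˡ a i b | splitAt-↑ˡ a j b = ≡.refl
      Eˡʳ : ∀ i y → E (i ↑ˡ b) (a ↑ʳ y) ≡ β i y
      Eˡʳ i y rewrite splitAt-↑ˡ a i b | splitAt-↑ʳ a b y = ≡.refl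
      Eʳˡ : ∀ y j → E (a ↑ʳ y) (j ↑ˡ b) ≡ 0#
      Eʳˡ y j rewrite splitAt-↑ʳ a b y | splitAt-↑ˡ a j b = ≡.refl
      Eʳʳ : ∀ y z → E (a ↑ʳ y) (a ↑ʳ z) ≡ δ y z
      Eʳʳ y z rewrite splitAt-↑ʳ a b y | splitAt-↑ʳ a b z = ≡.refl

      det-E : ∣ E ∣ ≈ x ^ a
      det-E = begin
        -- `E` is upper triangular in blocks; transposing moves its zero block to the upper right.
        ∣ E ∣               ≈⟨ det-transpose E ⟨
        ∣ (λ k l → E l k) ∣ ≈⟨ det-lower-triangular a (λ k l → E l k) (λ j y → reflexive (Eʳˡ y j)) ⟩
        ∣ (λ i j → E (j ↑ˡ b) (i ↑ˡ b)) ∣ * ∣ (λ y z → E (a ↑ʳ z) (a ↑ʳ y)) ∣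
          ≈⟨ *-cong (trans (det-transpose (λ i j → E (i ↑ˡ b) (j ↑ˡ b)))
                           (trans (det-cong λ i j → reflexive (Eˡˡ i j)) (det-scalar a x)))
                    (trans (det-transpose (λ y z → E (a ↑ʳ y) (a ↑ʳ z)))
                           (trans (det-cong λ y z → reflexive (Eʳʳ y z)) (det-δ b))) ⟩
        x ^ a * 1#          ≈⟨ *-identityʳ _ ⟩
        x ^ a               ∎

      upper : ∀ i k → (E ⊛ M) (i ↑ˡ b) k ≈ x * M (i ↑ˡ b) k + sum λ y → β i y * M (a ↑ʳ y) k
      upper i k = begin
        (E ⊛ M) (i ↑ˡ b) k ≈⟨ sum-↑ a (λ l → E (i ↑ˡ b) l * M l k) ⟩
        sum (λ j → E (i ↑ˡ b) (j ↑ˡ b) * M (j ↑ˡ b) k) + sum (λ y → E (i ↑ˡ b) (a ↑ʳ y) * M (a ↑ʳ y) k)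
          ≈⟨ +-cong (sum-cong-≋ λ j → trans (*-congʳ (reflexive (Eˡˡ i j))) (*-assoc _ _ _))
                    (sum-cong-≋ λ y → *-congʳ (reflexive (Eˡʳ i y))) ⟩
        sum (λ j → x * (δ i j * M (j ↑ˡ b) k)) + sum (λ y → β i y * M (a ↑ʳ y) k)
          ≈⟨ +-congʳ (trans (sym (*-distribˡ-sum x (λ j → δ i j * M (j ↑ˡ b) k))) (*-congˡ (sum-δˡ i (λ j → M (j ↑ˡ b) k)))) ⟩
        x * M (i ↑ˡ b) k + sum (λ y → β i y * M (a ↑ʳ y) k) ∎

      lower : ∀ y k → (E ⊛ M) (a ↑ʳ y) k ≈ M (a ↑ʳ y) k
      lower y k = begin
        (E ⊛ M) (a ↑ʳ y) k ≈⟨ sum-↑ a (λ l → E (a ↑ʳ y) l * M l k) ⟩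
        sum (λ j → E (a ↑ʳ y) (j ↑ˡ b) * M (j ↑ˡ b) k) + sum (λ z → E (a ↑ʳ y) (a ↑ʳ z) * M (a ↑ʳ z) k)
          ≈⟨ +-cong (sum-zero λ j → trans (*-congʳ (reflexive (Eʳˡ y j))) (zeroˡ _))
                    (trans (sum-cong-≋ λ z → *-congʳ (reflexive (Eʳʳ y z))) (sum-δˡ y (λ z → M (a ↑ʳ z) k))) ⟩
        0# + M (a ↑ʳ y) k ≈⟨ +-identityˡ _ ⟩
        M (a ↑ʳ y) k ∎

  det-blockDiagonal : ∀ k {p} (N : Matrix A p) (M : Matrix A (k ℕ.* p)) →
    (∀ (i : Fin k) y (j : Fin k) z → M (combine i y) (combine j z) ≈ (if ⌊ i ≟ j ⌋ then N y z else 0#)) →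
    ∣ M ∣ ≈ ∣ N ∣ ^ k
  det-blockDiagonal zero    N M M≈ = refl
  det-blockDiagonal (suc k) {p} N M M≈ = begin
    ∣ M ∣ ≈⟨ det-lower-triangular p M upperRight ⟩
    ∣ (λ y z → M (y ↑ˡ k ℕ.* p) (z ↑ˡ k ℕ.* p)) ∣ * ∣ (λ i j → M (p ↑ʳ i) (p ↑ʳ j)) ∣
      ≈⟨ *-cong (det-cong λ y z → M≈ zero y zero z) (det-blockDiagonal k N (λ i j → M (p ↑ʳ i) (p ↑ʳ j)) λ i y j z →
           trans (M≈ (suc i) y (suc j) z)
                 (reflexive (≡.cong (if_then N y z else 0#) (⌊≟⌋-injective {f = suc {n = k}} suc-injective i j)))) ⟩
    ∣ N ∣ * ∣ N ∣ ^ k ∎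
    where
    upperRight : ∀ y l → M (y ↑ˡ k ℕ.* p) (p ↑ʳ l) ≈ 0#
    upperRight y l with j , z , ≡.refl ← combine-surjective {k} {p} l = M≈ zero y (suc j) z

-- Polynomials

module PolynomialProperties {c ℓ} (R : CommutativeRing c ℓ) where
  open CommutativeRing R hiding (zero) renaming (Carrier to A)
  open import Algebra.Properties.Ring ring
  open import Algebra.Solver.Ring.NaturalCoefficients.Default commutativeSemiring
    using (solve; _:=_; _:+_; _:*_)
  open import Relation.Binary.Reasoning.Setoid setoid
  open Polynomial rawRing

  -- The commutative ring of coefficient lists

  scale : A → Poly → Poly
  scale a = map (a *_)

  coeff-+ₚ : ∀ p q i → coeff (p +ₚ q) i ≈ coeff p i + coeff q i
  coeff-+ₚ []      q       i       = sym (+-identityˡ _)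
  coeff-+ₚ (a ∷ p) []      i       = sym (+-identityʳ _)
  coeff-+ₚ (a ∷ p) (b ∷ q) zero    = refl
  coeff-+ₚ (a ∷ p) (b ∷ q) (suc i) = coeff-+ₚ p q i

  coeff--ₚ : ∀ p i → coeff (-ₚ p) i ≈ - coeff p i
  coeff--ₚ []      i       = sym -0#≈0#
  coeff--ₚ (a ∷ p) zero    = refl
  coeff--ₚ (a ∷ p) (suc i) = coeff--ₚ p i

  coeff-scale : ∀ a p i → coeff (scale a p) i ≈ a * coeff p i
  coeff-scale a []      i       = sym (zeroʳ a)
  coeff-scale a (b ∷ p) zero    = refl
  coeff-scale a (b ∷ p) (suc i) = coeff-scale a p i

  coeff-∷* : ∀ a p q i → coeff ((a ∷ p) *ₚ q) i ≈ a * coeff q i + coeff (0# ∷ p *ₚ q) i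
  coeff-∷* a p q i = trans (coeff-+ₚ (scale a q) _ i) (+-congʳ (coeff-scale a q i))

  coeff-0∷-cong : ∀ {p q} → p ≈ₚ q → ∀ i → coeff (0# ∷ p) i ≈ coeff (0# ∷ q) i
  coeff-0∷-cong p≈q zero    = refl
  coeff-0∷-cong p≈q (suc i) = p≈q i

  coeff-length : ∀ p i → length p ℕ.≤ i → coeff p i ≈ 0#
  coeff-length []      i       _         = refl
  coeff-length (a ∷ p) (suc i) (s≤s p≤i) = coeff-length p i p≤i

  *ₚ-congˡ : ∀ p q r → q ≈ₚ r → p *ₚ q ≈ₚ p *ₚ r
  *ₚ-congˡ []      q r q≈r i = refl
  *ₚ-congˡ (a ∷ p) q r q≈r i = begin
    coeff ((a ∷ p) *ₚ q) i              ≈⟨ coeff-∷* a p q i ⟩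
    a * coeff q i + coeff (0# ∷ p *ₚ q) i
      ≈⟨ +-cong (*-congˡ (q≈r i)) (coeff-0∷-cong {p *ₚ q} {p *ₚ r} (*ₚ-congˡ p q r q≈r) i) ⟩
    a * coeff r i + coeff (0# ∷ p *ₚ r) i ≈⟨ coeff-∷* a p r i ⟨
    coeff ((a ∷ p) *ₚ r) i              ∎

  *ₚ-zeroʳ : ∀ p → p *ₚ [] ≈ₚ []
  *ₚ-zeroʳ []      i       = refl
  *ₚ-zeroʳ (a ∷ p) zero    = refl
  *ₚ-zeroʳ (a ∷ p) (suc i) = *ₚ-zeroʳ p i

  -- The product is defined by recursion on the left factor; this is the matching recursion on the
  -- right factor, from which commutativity follows.
  *ₚ-∷ : ∀ p b q i → coeff (p *ₚ (b ∷ q)) i ≈ b * coeff p i + coeff (0# ∷ p *ₚ q) i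
  *ₚ-∷ []      b q zero    = sym (trans (+-identityʳ _) (zeroʳ b))
  *ₚ-∷ []      b q (suc i) = sym (trans (+-identityʳ _) (zeroʳ b))
  *ₚ-∷ (a ∷ p) b q zero    = +-congʳ (*-comm a b)
  *ₚ-∷ (a ∷ p) b q (suc i) = begin
    coeff (scale a q +ₚ p *ₚ (b ∷ q)) i                      ≈⟨ coeff-+ₚ (scale a q) _ i ⟩
    coeff (scale a q) i + coeff (p *ₚ (b ∷ q)) i             ≈⟨ +-cong (coeff-scale a q i) (*ₚ-∷ p b q i) ⟩
    a * coeff q i + (b * coeff p i + coeff (0# ∷ p *ₚ q) i)  ≈⟨ solve 3 (λ x y z → x :+ (y :+ z) := y :+ (x :+ z)) refl _ _ _ ⟩
    b * coeff p i + (a * coeff q i + coeff (0# ∷ p *ₚ q) i)  ≈⟨ +-congˡ (coeff-∷* a p q i) ⟨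
    b * coeff p i + coeff ((a ∷ p) *ₚ q) i                   ∎

  *ₚ-comm : ∀ p q → p *ₚ q ≈ₚ q *ₚ p
  *ₚ-comm []      q i = sym (*ₚ-zeroʳ q i)
  *ₚ-comm (a ∷ p) q i = begin
    coeff ((a ∷ p) *ₚ q) i                ≈⟨ coeff-∷* a p q i ⟩
    a * coeff q i + coeff (0# ∷ p *ₚ q) i ≈⟨ +-congˡ (coeff-0∷-cong {p *ₚ q} {q *ₚ p} (*ₚ-comm p q) i) ⟩
    a * coeff q i + coeff (0# ∷ q *ₚ p) i ≈⟨ *ₚ-∷ q a p i ⟨
    coeff (q *ₚ (a ∷ p)) i                ∎

  *ₚ-congʳ : ∀ p q r → q ≈ₚ r → q *ₚ p ≈ₚ r *ₚ p
  *ₚ-congʳ p q r q≈r i = trans (*ₚ-comm q p i) (trans (*ₚ-congˡ p q r q≈r i) (*ₚ-comm p r i))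

  *ₚ-distribʳ : ∀ p q r → (q +ₚ r) *ₚ p ≈ₚ q *ₚ p +ₚ r *ₚ p
  *ₚ-distribʳ p []      r       i = refl
  *ₚ-distribʳ p (a ∷ q) []      i = sym (trans (coeff-+ₚ ((a ∷ q) *ₚ p) [] i) (+-identityʳ _))
  *ₚ-distribʳ p (a ∷ q) (b ∷ r) i = begin
    coeff ((a + b ∷ q +ₚ r) *ₚ p) i  ≈⟨ coeff-∷* (a + b) (q +ₚ r) p i ⟩
    (a + b) * coeff p i + coeff (0# ∷ (q +ₚ r) *ₚ p) i
      ≈⟨ +-congˡ (trans (coeff-0∷-cong {(q +ₚ r) *ₚ p} {q *ₚ p +ₚ r *ₚ p} (*ₚ-distribʳ p q r) i) (shift i)) ⟩
    (a + b) * coeff p i + (coeff (0# ∷ q *ₚ p) i + coeff (0# ∷ r *ₚ p) i)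
      ≈⟨ solve 5 (λ a b p x y → (a :+ b) :* p :+ (x :+ y) := (a :* p :+ x) :+ (b :* p :+ y)) refl a b (coeff p i) _ _ ⟩
    (a * coeff p i + coeff (0# ∷ q *ₚ p) i) + (b * coeff p i + coeff (0# ∷ r *ₚ p) i)
      ≈⟨ +-cong (coeff-∷* a q p i) (coeff-∷* b r p i) ⟨
    coeff ((a ∷ q) *ₚ p) i + coeff ((b ∷ r) *ₚ p) i ≈⟨ coeff-+ₚ ((a ∷ q) *ₚ p) _ i ⟨
    coeff ((a ∷ q) *ₚ p +ₚ (b ∷ r) *ₚ p) i ∎
    where
    shift : ∀ i → coeff (0# ∷ (q *ₚ p +ₚ r *ₚ p)) i ≈ coeff (0# ∷ q *ₚ p) i + coeff (0# ∷ r *ₚ p) i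
    shift zero    = sym (+-identityˡ _)
    shift (suc i) = coeff-+ₚ (q *ₚ p) (r *ₚ p) i

  scale-*ₚ : ∀ a p q → scale a p *ₚ q ≈ₚ scale a (p *ₚ q)
  scale-*ₚ a []      q i = refl
  scale-*ₚ a (b ∷ p) q i = begin
    coeff ((a * b ∷ scale a p) *ₚ q) i           ≈⟨ coeff-∷* (a * b) (scale a p) q i ⟩
    a * b * coeff q i + coeff (0# ∷ scale a p *ₚ q) i
      ≈⟨ +-cong (*-assoc _ _ _) (trans (coeff-0∷-cong {scale a p *ₚ q} {scale a (p *ₚ q)} (scale-*ₚ a p q) i) (shift i)) ⟩
    a * (b * coeff q i) + a * coeff (0# ∷ p *ₚ q) i ≈⟨ distribˡ a _ _ ⟨
    a * (b * coeff q i + coeff (0# ∷ p *ₚ q) i)   ≈⟨ *-congˡ (coeff-∷* b p q i) ⟨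
    a * coeff ((b ∷ p) *ₚ q) i                    ≈⟨ coeff-scale a ((b ∷ p) *ₚ q) i ⟨
    coeff (scale a ((b ∷ p) *ₚ q)) i              ∎
    where
    shift : ∀ i → coeff (0# ∷ scale a (p *ₚ q)) i ≈ a * coeff (0# ∷ p *ₚ q) i
    shift zero    = sym (zeroʳ a)
    shift (suc i) = coeff-scale a (p *ₚ q) i

  *ₚ-assoc : ∀ p q r → (p *ₚ q) *ₚ r ≈ₚ p *ₚ (q *ₚ r)
  *ₚ-assoc []      q r i = refl
  *ₚ-assoc (a ∷ p) q r i = begin
    coeff ((scale a q +ₚ (0# ∷ p *ₚ q)) *ₚ r) i
      ≈⟨ *ₚ-distribʳ r (scale a q) (0# ∷ p *ₚ q) i ⟩
    coeff (scale a q *ₚ r +ₚ (0# ∷ p *ₚ q) *ₚ r) i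
      ≈⟨ coeff-+ₚ (scale a q *ₚ r) _ i ⟩
    coeff (scale a q *ₚ r) i + coeff ((0# ∷ p *ₚ q) *ₚ r) i
      ≈⟨ +-cong (scale-*ₚ a q r i) (trans (coeff-∷* 0# (p *ₚ q) r i) (trans (+-congʳ (zeroˡ _)) (+-identityˡ _))) ⟩
    coeff (scale a (q *ₚ r)) i + coeff (0# ∷ (p *ₚ q) *ₚ r) i
      ≈⟨ +-congˡ (coeff-0∷-cong {(p *ₚ q) *ₚ r} {p *ₚ (q *ₚ r)} (*ₚ-assoc p q r) i) ⟩
    coeff (scale a (q *ₚ r)) i + coeff (0# ∷ p *ₚ (q *ₚ r)) i
      ≈⟨ coeff-+ₚ (scale a (q *ₚ r)) _ i ⟨
    coeff ((a ∷ p) *ₚ (q *ₚ r)) i ∎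

  *ₚ-identityˡ : ∀ p → constant 1# *ₚ p ≈ₚ p
  *ₚ-identityˡ p i = trans (coeff-∷* 1# [] p i)
    (trans (+-cong (*-identityˡ _) (0∷[] i)) (+-identityʳ _))
    where
    0∷[] : ∀ i → coeff (0# ∷ []) i ≈ 0#
    0∷[] zero    = refl
    0∷[] (suc i) = refl

  -- Its raw ring is definitionally `polyRing`, so the determinant theory applies to `charPoly` as
  -- it stands.
  polyCommutativeRing : CommutativeRing c ℓ
  polyCommutativeRing = record
    { Carrier = Poly
    ; _≈_ = _≈ₚ_
    ; _+_ = _+ₚ_
    ; _*_ = _*ₚ_
    ; -_  = -ₚ_
    ; 0#  = []
    ; 1#  = constant 1#
    ; isCommutativeRing = record
      { isRing = record
        { +-isAbelianGroup = record
          { isGroup = record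
            { isMonoid = record
              { isSemigroup = record
                { isMagma = record
                  { isEquivalence = record
                    { refl  = λ i → refl
                    ; sym   = λ p≈q i → sym (p≈q i)
                    ; trans = λ p≈q q≈r i → trans (p≈q i) (q≈r i)
                    }
                  ; ∙-cong = λ {p} {q} {r} {s} p≈q r≈s i →
                      trans (coeff-+ₚ p r i) (trans (+-cong (p≈q i) (r≈s i)) (sym (coeff-+ₚ q s i)))
                  }
                ; assoc = λ p q r i → begin
                    coeff ((p +ₚ q) +ₚ r) i              ≈⟨ coeff-+ₚ (p +ₚ q) r i ⟩
                    coeff (p +ₚ q) i + coeff r i         ≈⟨ +-congʳ (coeff-+ₚ p q i) ⟩
                    coeff p i + coeff q i + coeff r i    ≈⟨ +-assoc _ _ _ ⟩
                    coeff p i + (coeff q i + coeff r i)  ≈⟨ +-congˡ (coeff-+ₚ q r i) ⟨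
                    coeff p i + coeff (q +ₚ r) i         ≈⟨ coeff-+ₚ p (q +ₚ r) i ⟨
                    coeff (p +ₚ (q +ₚ r)) i              ∎
                }
              ; identity = (λ p i → refl) , λ p i → trans (coeff-+ₚ p [] i) (+-identityʳ _)
              }
            ; inverse = (λ p i → trans (coeff-+ₚ (-ₚ p) p i) (trans (+-congʳ (coeff--ₚ p i)) (-‿inverseˡ _)))
                      , (λ p i → trans (coeff-+ₚ p (-ₚ p) i) (trans (+-congˡ (coeff--ₚ p i)) (-‿inverseʳ _)))
            ; ⁻¹-cong = λ {p} {q} p≈q i → trans (coeff--ₚ p i) (trans (-‿cong (p≈q i)) (sym (coeff--ₚ q i)))
            }
          ; comm = λ p q i → trans (coeff-+ₚ p q i) (trans (+-comm _ _) (sym (coeff-+ₚ q p i)))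
          }
        ; *-cong = λ {p} {q} {r} {s} p≈q r≈s i → trans (*ₚ-congʳ r p q p≈q i) (*ₚ-congˡ q r s r≈s i)
        ; *-assoc = *ₚ-assoc
        ; *-identity = *ₚ-identityˡ , λ p i → trans (*ₚ-comm p (constant 1#) i) (*ₚ-identityˡ p i)
        ; distrib = (λ p q r i → trans (*ₚ-comm p (q +ₚ r) i) (trans (*ₚ-distribʳ p q r i)
                      (trans (coeff-+ₚ (q *ₚ p) (r *ₚ p) i) (trans (+-cong (*ₚ-comm q p i) (*ₚ-comm r p i))
                        (sym (coeff-+ₚ (p *ₚ q) (p *ₚ r) i))))))
                  , *ₚ-distribʳ
        }
      ; *-comm = *ₚ-comm
      }
    }

  module S = CommutativeRing polyCommutativeRing
  module D = Determinant polyCommutativeRing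

  -- Linear factors and cancellation

  X-_ : A → Poly
  X- μ = X +ₚ (-ₚ constant μ)

  coeff-X-* : ∀ μ q i → coeff ((X- μ) *ₚ q) (suc i) ≈ - μ * coeff q (suc i) + coeff q i
  coeff-X-* μ q i = begin
    coeff ((X- μ) *ₚ q) (suc i)
      ≈⟨ coeff-∷* (0# + - μ) (1# ∷ []) q (suc i) ⟩
    (0# + - μ) * coeff q (suc i) + coeff (constant 1# *ₚ q) i
      ≈⟨ +-cong (*-congʳ (+-identityˡ _)) (*ₚ-identityˡ q i) ⟩
    - μ * coeff q (suc i) + coeff q i ∎

  -- Equality of coefficients need not be decidable, so the leading coefficient of an arbitrary
  -- polynomial cannot be located. Cancellation is therefore a property established for the
  -- particular factors, whose leading coefficient is known to be 1.
  Cancellable : Poly → Set _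
  Cancellable d = ∀ p q → d *ₚ p ≈ₚ d *ₚ q → p ≈ₚ q

  -- Coefficients are compared from the top down, starting beyond both degrees.
  X-‿cancellable : ∀ μ → Cancellable (X- μ)
  X-‿cancellable μ p q dp≈dq i = descend (length p ℕ.+ length q) i (ℕ.m≤m+n _ i)
    where
    descend : ∀ k i → length p ℕ.+ length q ℕ.≤ k ℕ.+ i → coeff p i ≈ coeff q i
    descend zero i le = trans (coeff-length p i (ℕ.m+n≤o⇒m≤o _ le))
                              (sym (coeff-length q i (ℕ.m+n≤o⇒n≤o (length p) le)))
    descend (suc k) i le = +-cancelˡ _ _ _ (begin
      - μ * coeff p (suc i) + coeff p i ≈⟨ coeff-X-* μ p i ⟨
      coeff ((X- μ) *ₚ p) (suc i)       ≈⟨ dp≈dq (suc i) ⟩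
      coeff ((X- μ) *ₚ q) (suc i)       ≈⟨ coeff-X-* μ q i ⟩
      - μ * coeff q (suc i) + coeff q i ≈⟨ +-congʳ (*-congˡ (descend k (suc i) (≡.subst (length p ℕ.+ length q ℕ.≤_) (≡.sym (ℕ.+-suc k i)) le))) ⟨
      - μ * coeff p (suc i) + coeff q i ∎)

  ∏[X-]-cancellable : ∀ λs → Cancellable ∏[X- λs ]
  ∏[X-]-cancellable [] p q eq i =
    trans (sym (*ₚ-identityˡ p i)) (trans (eq i) (*ₚ-identityˡ q i))
  ∏[X-]-cancellable (μ ∷ λs) p q eq =
    ∏[X-]-cancellable λs p q (X-‿cancellable μ (∏[X- λs ] *ₚ p) (∏[X- λs ] *ₚ q) λ i →
      trans (sym (*ₚ-assoc (X- μ) ∏[X- λs ] p i)) (trans (eq i) (*ₚ-assoc (X- μ) ∏[X- λs ] q i)))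

  cancellable-resp : ∀ d e → d ≈ₚ e → Cancellable e → Cancellable d
  cancellable-resp d e d≈e cancel p q dp≈dq = cancel p q λ i →
    trans (sym (*ₚ-congʳ p d e d≈e i)) (trans (dp≈dq i) (*ₚ-congʳ q d e d≈e i))

  -- Degree bounds and monic polynomials

  -- A strict bound takes the place of a degree: it makes sense for the zero polynomial and ignores
  -- trailing zeros.
  Degree< : ℕ → Poly → Set ℓ
  Degree< d p = ∀ i → d ℕ.≤ i → coeff p i ≈ 0#

  Monic : ℕ → Poly → Set ℓ
  Monic d p = coeff p d ≈ 1# × Degree< (suc d) p

  degree-constant : ∀ a → Degree< 1 (constant a)
  degree-constant a (suc i) _ = refl

  degree-[] : ∀ d → Degree< d []
  degree-[] d i _ = refl

  degree-≤ : ∀ {d e} p → d ℕ.≤ e → Degree< d p → Degree< e p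
  degree-≤ p d≤e <p i e≤i = <p i (ℕ.≤-trans d≤e e≤i)

  degree-+ : ∀ {d} p q → Degree< d p → Degree< d q → Degree< d (p +ₚ q)
  degree-+ p q <p <q i d≤i = trans (coeff-+ₚ p q i) (trans (+-cong (<p i d≤i) (<q i d≤i)) (+-identityˡ _))

  -- Both bounds are strict, so degree at most `d` is added to degree below `n`; this explains the
  -- missing successor in the conclusion.
  degree-* : ∀ d {n} p q → Degree< (suc d) p → Degree< n q → Degree< (d ℕ.+ n) (p *ₚ q)
  degree-* d [] q <p <q i _ = refl
  degree-* zero (a ∷ p) q <p <q i n≤i = begin
    coeff ((a ∷ p) *ₚ q) i                ≈⟨ coeff-∷* a p q i ⟩
    a * coeff q i + coeff (0# ∷ p *ₚ q) i ≈⟨ +-cong (*-congˡ (<q i n≤i)) (coeff-0∷-cong {p *ₚ q} {[]} p*q≈0 i) ⟩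
    a * 0# + coeff (0# ∷ []) i            ≈⟨ +-cong (zeroʳ a) (degree-0∷[] i) ⟩
    0# + 0#                               ≈⟨ +-identityˡ _ ⟩
    0#                                    ∎
    where
    p*q≈0 : p *ₚ q ≈ₚ []
    p*q≈0 = *ₚ-congʳ q p [] λ i → <p (suc i) (s≤s z≤n)
    degree-0∷[] : ∀ i → coeff (0# ∷ []) i ≈ 0#
    degree-0∷[] zero    = refl
    degree-0∷[] (suc i) = refl
  degree-* (suc d) {n} (a ∷ p) q <p <q (suc i) (s≤s d+n≤i) = begin
    coeff ((a ∷ p) *ₚ q) (suc i)              ≈⟨ coeff-∷* a p q (suc i) ⟩
    a * coeff q (suc i) + coeff (p *ₚ q) i    ≈⟨ +-cong (*-congˡ (<q (suc i) (ℕ.m≤n⇒m≤1+n (ℕ.m+n≤o⇒n≤o d d+n≤i))))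
                                                        (degree-* d p q (λ j d<j → <p (suc j) (s≤s d<j)) <q i d+n≤i) ⟩
    a * 0# + 0#                               ≈⟨ +-identityʳ _ ⟩
    a * 0#                                    ≈⟨ zeroʳ a ⟩
    0#                                        ∎

  open import Algebra.Properties.Semiring.Sum S.semiring using (sum; sum-cong-≋)

  degree-sum : ∀ {d n} (t : Fin n → Poly) → (∀ i → Degree< d (t i)) → Degree< d (sum t)
  degree-sum {d} {zero}  t <t = degree-[] d
  degree-sum {d} {suc n} t <t = degree-+ (t zero) _ (<t zero) (degree-sum (t ∘ suc) (<t ∘ suc))

  degree-sign : ∀ {n} (j : Fin n) → Degree< 1 (D.sign j)
  degree-sign zero    = degree-constant 1#
  degree-sign (suc j) = degree-* 0 (-ₚ constant 1#) (D.sign j) (degree-constant (- 1#)) (degree-sign j)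

  degree-det : ∀ {n} (M : Matrix Poly n) → (∀ i j → Degree< 2 (M i j)) → Degree< (suc n) (det polyRing M)
  degree-det {zero}  M <M = degree-constant 1#
  degree-det {suc n} M <M = degree-sum (λ j → D.sign j *ₚ (M zero j *ₚ det polyRing (D.minor j M))) λ j →
    degree-* 0 (D.sign j) _ (degree-sign j)
      (degree-* 1 (M zero j) _ (<M zero j) (degree-det (D.minor j M) λ a b → <M (suc a) (punchIn j b)))

  -- Every product in the expanded determinant takes one entry from row `i`, and that entry is
  -- constant: the bound of `degree-det` drops by one.
  degree-det-constantRow : ∀ {n} (M : Matrix Poly n) → (∀ i j → Degree< 2 (M i j)) →
                           ∀ i → (∀ j → Degree< 1 (M i j)) → Degree< n (det polyRing M)
  degree-det-constantRow {suc n} M <M zero <Mᵢ =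
    degree-sum (λ j → D.sign j *ₚ (M zero j *ₚ det polyRing (D.minor j M))) λ j →
    degree-* 0 (D.sign j) _ (degree-sign j)
      (degree-* 0 (M zero j) _ (<Mᵢ j) (degree-det (D.minor j M) λ a b → <M (suc a) (punchIn j b)))
  degree-det-constantRow {suc n} M <M (suc i) <Mᵢ =
    degree-sum (λ j → D.sign j *ₚ (M zero j *ₚ det polyRing (D.minor j M))) λ j →
    degree-* 0 (D.sign j) _ (degree-sign j)
      (degree-* 1 (M zero j) _ (<M zero j)
        (degree-det-constantRow (D.minor j M) (λ a b → <M (suc a) (punchIn j b)) i λ b → <Mᵢ (punchIn j b)))

  monic-resp : ∀ {d} p q → p ≈ₚ q → Monic d q → Monic d p
  monic-resp p q p≈q (lead , <q) = trans (p≈q _) lead , λ i d<i → trans (p≈q i) (<q i d<i)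

  monic-+ : ∀ {d} p q → Monic d p → Degree< d q → Monic d (p +ₚ q)
  monic-+ {d} p q (lead , <p) <q =
    trans (coeff-+ₚ p q d) (trans (+-cong lead (<q d ℕ.≤-refl)) (+-identityʳ _)) ,
    degree-+ p q <p (degree-≤ q (ℕ.n≤1+n d) <q)

  monic-X-* : ∀ {d} μ q → Monic d q → Monic (suc d) ((X- μ) *ₚ q)
  monic-X-* {d} μ q (lead , <q) = top , above
    where
    top : coeff ((X- μ) *ₚ q) (suc d) ≈ 1#
    top = trans (coeff-X-* μ q d) (trans (+-cong (trans (*-congˡ (<q (suc d) ℕ.≤-refl)) (zeroʳ _)) lead) (+-identityˡ _))
    above : Degree< (suc (suc d)) ((X- μ) *ₚ q)
    above (suc i) (s≤s d<i) = trans (coeff-X-* μ q i)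
      (trans (+-cong (trans (*-congˡ (<q (suc i) (ℕ.m≤n⇒m≤1+n d<i))) (zeroʳ _)) (<q i d<i)) (+-identityˡ _))

  monic-X- : ∀ μ → Monic 1 (X- μ)
  monic-X- μ = refl , λ { (suc (suc i)) _ → refl ; (suc zero) (s≤s ()) }

  charMatrix : ∀ {n} → Matrix A n → Matrix Poly n
  charMatrix M i j = (if ⌊ i ≟ j ⌋ then X else []) +ₚ (-ₚ constant (M i j))

  -- In the expansion along the first row only the diagonal term has full degree: it is a linear
  -- factor times a smaller characteristic polynomial.
  charPoly-monic : ∀ {n} (M : Matrix A n) → Monic n (charPoly M)
  charPoly-monic {zero}  M = refl , degree-constant 1#
  charPoly-monic {suc n} M = monic-+ (term zero) (sum (term ∘ suc))
    (monic-resp (term zero) ((X- M zero zero) *ₚ charPoly M′) term₀ (monic-X-* (M zero zero) (charPoly M′) (charPoly-monic M′)))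
    (degree-sum (term ∘ suc) λ j →
      degree-* 0 (D.sign (suc j)) _ (degree-sign (suc j))
        (degree-* 0 (C zero (suc j)) (det polyRing (D.minor (suc j) C)) (degree-constant _)
          (degree-≤ (det polyRing (D.minor (suc j) C)) (ℕ.n≤1+n n) (small j))))
    where
    C = charMatrix M
    M′ : Matrix A n
    M′ i j = M (suc i) (suc j)
    term : Fin (suc n) → Poly
    term j = D.sign j *ₚ (C zero j *ₚ det polyRing (D.minor j C))
    term₀ : term zero ≈ₚ (X- M zero zero) *ₚ charPoly M′
    term₀ i = trans (*ₚ-identityˡ (C zero zero *ₚ det polyRing (D.minor zero C)) i)
      (*ₚ-congˡ (X- M zero zero) (det polyRing (D.minor zero C)) (charPoly M′)
        (D.det-cong {M = D.minor zero C} {charMatrix M′} λ i j k → entry i j k) i)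
      where
      entry : ∀ i j → C (suc i) (suc j) ≈ₚ charMatrix M′ i j
      entry i j k rewrite ⌊≟⌋-injective {f = suc {n}} suc-injective i j = refl
    degree-C : ∀ i j → Degree< 2 (C i j)
    degree-C i j with ⌊ i ≟ j ⌋
    ... | true  = λ { (suc (suc i)) _ → refl ; (suc zero) (s≤s ()) }
    ... | false = λ { (suc i) _ → refl }
    degree-C-≢ : ∀ i j → i ≢ j → Degree< 1 (C i j)
    degree-C-≢ i j i≢j rewrite ⌊≟⌋-≢ i≢j = degree-constant _
    small : ∀ j → Degree< n (det polyRing (D.minor (suc j) C))
    -- Row `j` of this minor comes from row `suc j` of `C`, whose diagonal entry has been deleted,
    -- so only constants are left in it.
    small j = degree-det-constantRow (D.minor (suc j) C) (λ a b → degree-C (suc a) (punchIn (suc j) b)) j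
      λ b → degree-C-≢ (suc j) (punchIn (suc j) b) (punchInᵢ≢i (suc j) b ∘ ≡.sym)

  -- Splitting monic polynomials over an algebraically closed field

  monicList : List A → Poly
  monicList as = as ++ 1# ∷ []

  -- Algebraic closedness speaks of lists that end in an explicit 1; this brings a monic polynomial
  -- with possible trailing zeros into that shape.
  monic⇒monicList : ∀ d p → Monic d p → ∃ λ as → length as ≡ d × p ≈ₚ monicList as
  monic⇒monicList zero p (lead , <p) = [] , ≡.refl , λ { zero → lead ; (suc i) → <p (suc i) (s≤s z≤n) }
  -- An empty list is monic only if 0 and 1 coincide, which a commutative ring does not exclude; it
  -- is then padded with zeros.
  monic⇒monicList (suc d) [] (lead , <p)
    with as , eq , []≈ ← monic⇒monicList d [] (lead , degree-[] (suc d))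
    = 0# ∷ as , ≡.cong suc eq , λ { zero → refl ; (suc i) → []≈ i }
  monic⇒monicList (suc d) (a ∷ p) (lead , <p)
    with as , eq , p≈ ← monic⇒monicList d p (lead , λ i d<i → <p (suc i) (s≤s d<i))
    = a ∷ as , ≡.cong suc eq , λ { zero → refl ; (suc i) → p≈ i }

  -- Horner's scheme: for any a, monicList (hornerQuotient as x) is the quotient of
  -- monicList (a ∷ as) by X - x.
  hornerQuotient : List A → A → List A
  hornerQuotient []       x = []
  hornerQuotient (a ∷ as) x = eval (monicList (a ∷ as)) x ∷ hornerQuotient as x

  length-hornerQuotient : ∀ as x → length (hornerQuotient as x) ≡ length as
  length-hornerQuotient []       x = ≡.refl
  length-hornerQuotient (a ∷ as) x = ≡.cong suc (length-hornerQuotient as x)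

  head-hornerQuotient : ∀ as x → coeff (monicList (hornerQuotient as x)) 0 ≈ eval (monicList as) x
  head-hornerQuotient []       x = sym (trans (+-congˡ (zeroʳ x)) (+-identityʳ _))
  head-hornerQuotient (a ∷ as) x = refl

  -- The left side is coefficient i + 1 of the product of X - x with the quotient, the right side
  -- coefficient i + 1 of the dividend `monicList (a ∷ as)`. The constant `a` does not enter.
  coeff-hornerQuotient : ∀ as x i → let q = monicList (hornerQuotient as x) in
                   - x * coeff q (suc i) + coeff q i ≈ coeff (monicList as) i
  coeff-hornerQuotient []       x zero    = trans (+-congʳ (zeroʳ _)) (+-identityˡ _)
  coeff-hornerQuotient []       x (suc i) = trans (+-congʳ (zeroʳ _)) (+-identityˡ _)
  coeff-hornerQuotient (a ∷ as) x (suc i) = coeff-hornerQuotient as x i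
  coeff-hornerQuotient (a ∷ as) x zero    = begin
    - x * coeff (monicList (hornerQuotient as x)) 0 + (a + x * e)  ≈⟨ +-cong (*-congˡ (head-hornerQuotient as x)) (+-comm _ _) ⟩
    - x * e + (x * e + a)                                    ≈⟨ +-assoc _ _ _ ⟨
    - x * e + x * e + a                                      ≈⟨ +-congʳ (trans (+-congʳ (sym (-‿distribˡ-* x e))) (-‿inverseˡ _)) ⟩
    0# + a                                                   ≈⟨ +-identityˡ _ ⟩
    a                                                        ∎
    where e = eval (monicList as) x

  root⇒factor : ∀ a as x → eval (monicList (a ∷ as)) x ≈ 0# →
                monicList (a ∷ as) ≈ₚ (X- x) *ₚ monicList (hornerQuotient as x)
  root⇒factor a as x root (suc i) =
    sym (trans (coeff-X-* x (monicList (hornerQuotient as x)) i) (coeff-hornerQuotient as x i))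
  -- The constant coefficient carries the remainder of the division, and the root makes it vanish.
  root⇒factor a as x root zero = sym (begin
    coeff ((X- x) *ₚ q) 0     ≈⟨ coeff-∷* (0# + - x) (1# ∷ []) q 0 ⟩
    (0# + - x) * coeff q 0 + 0#  ≈⟨ +-identityʳ _ ⟩
    (0# + - x) * coeff q 0       ≈⟨ *-cong (+-identityˡ _) (head-hornerQuotient as x) ⟩
    - x * e                      ≈⟨ -‿distribˡ-* x e ⟨
    - (x * e)                    ≈⟨ +-inverseˡ-unique a (x * e) root ⟨
    a                            ∎)
    where
    q = monicList (hornerQuotient as x)
    e = eval (monicList as) x

  module _ (root : ∀ a as → ∃ λ x → eval (monicList (a ∷ as)) x ≈ 0#) where

    -- The recursion is on the length, since the Horner quotient is a new list and not a part of the
    -- old one.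
    monicList-splits : ∀ d as → length as ≡ d → ∃ λ λs → monicList as ≈ₚ ∏[X- λs ]
    monicList-splits zero    []       _  = [] , λ i → refl
    monicList-splits (suc d) (a ∷ as) eq
      with x , eval≈0 ← root a as
      with λs , q≈ ← monicList-splits d (hornerQuotient as x) (≡.trans (length-hornerQuotient as x) (ℕ.suc-injective eq))
      = x ∷ λs , λ i → trans (root⇒factor a as x eval≈0 i)
                             (*ₚ-congˡ (X- x) (monicList (hornerQuotient as x)) ∏[X- λs ] q≈ i)

    monic-splits : ∀ d p → Monic d p → ∃ λ λs → p ≈ₚ ∏[X- λs ]
    monic-splits d p monic
      with as , eq , p≈ ← monic⇒monicList d p monic
      with λs , as≈ ← monicList-splits d as eq
      = λs , λ i → trans (p≈ i) (as≈ i)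

    monic-cancellable : ∀ d p → Monic d p → Cancellable p
    monic-cancellable d p monic with λs , p≈ ← monic-splits d p monic
      = cancellable-resp p ∏[X- λs ] p≈ (∏[X-]-cancellable λs)

-- Graphs with pockets

∣tabulate∣-punchIn : ∀ {p} (f : Fin (suc p) → Bool) w → f w ≡ false →
                     ∣ tabulate f ∣ˢ ≡ ∣ tabulate (f ∘ punchIn w) ∣ˢ
∣tabulate∣-punchIn f zero f[w]≡false rewrite f[w]≡false = ≡.refl
∣tabulate∣-punchIn {suc p} f (suc w) f[w]≡false with f zero
... | true  = ≡.cong suc (∣tabulate∣-punchIn (f ∘ suc) w f[w]≡false)
... | false = ∣tabulate∣-punchIn (f ∘ suc) w f[w]≡false

-- Without a loop at `w`, all p neighbours lie among the p other vertices, and a subset of full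
-- cardinality contains everything.
dominating⇒adj : ∀ {p} (H : Graph (suc p)) w → degree H w ≡ p →
                 ∀ y → adj H w (punchIn w y) ≡ true
dominating⇒adj {p} H w degree≡p y = begin
  adj H w (punchIn w y)                               ≡⟨ lookup∘tabulate (adj H w ∘ punchIn w) y ⟨
  lookup (tabulate (adj H w ∘ punchIn w)) y           ≡⟨ ≡.cong (λ s → lookup s y) (∣p∣≡n⇒p≡⊤ {p = tabulate (adj H w ∘ punchIn w)} full) ⟩
  lookup (⊤ {p}) y                                    ≡⟨ lookup-replicate y true ⟩
  true                                                ∎
  where
  open ≡.≡-Reasoning
  full : ∣ tabulate (adj H w ∘ punchIn w) ∣ˢ ≡ p
  full = ≡.trans (≡.sym (∣tabulate∣-punchIn (adj H w) w (adj-irrefl H w))) degree≡p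

pocketVertex-↑ˡ : ∀ {n} k p a → pocketVertex n k p (a ↑ˡ k ℕ.* p) ≡ inj₁ a
pocketVertex-↑ˡ {n} k p a rewrite splitAt-↑ˡ n a (k ℕ.* p) = ≡.refl

pocketVertex-↑ʳ : ∀ n {k p} (i : Fin k) (y : Fin p) → pocketVertex n k p (n ↑ʳ combine i y) ≡ inj₂ (i , y)
pocketVertex-↑ʳ n {k} {p} i y rewrite splitAt-↑ʳ n (k ℕ.* p) (combine i y) = ≡.cong inj₂ (remQuot-combine i y)

-- The graph computation takes place in any commutative ring with a chosen element `x`; it is later
-- used in K[X] with x = X.
module CharacteristicMatrix {c ℓ} (R : CommutativeRing c ℓ) (x : CommutativeRing.Carrier R) where
  open CommutativeRing R hiding (zero) renaming (Carrier to A)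
  open Determinant R
  open import Algebra.Properties.Ring ring
  open import Algebra.Properties.Semiring.Sum semiring
  open import Algebra.Definitions.RawSemiring (RawRing.rawSemiring rawRing) using (_^_) renaming (_×_ to _·_)
  open import Algebra.Solver.Ring.NaturalCoefficients.Default commutativeSemiring
    using (solve; _:=_; _:+_; _:*_; con)
  open import Relation.Binary.Reasoning.Setoid setoid

  -- Characteristic matrices of graphs and cones

  ⟦_⟧ : Bool → A
  ⟦ b ⟧ = if b then 1# else 0#

  characteristic : ∀ {n} → Graph n → Matrix A n
  characteristic G i j = (if ⌊ i ≟ j ⌋ then x else 0#) - signlessLaplacian rawRing G i j

  φ : ∀ {n} → Graph n → A
  φ G = ∣ characteristic G ∣

  characteristic-cong : ∀ {m n} (G : Graph m) (H : Graph n) {i j i′ j′} →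
    ⌊ i ≟ j ⌋ ≡ ⌊ i′ ≟ j′ ⌋ → adj G i j ≡ adj H i′ j′ → degree G i · 1# ≈ degree H i′ · 1# →
    characteristic G i j ≈ characteristic H i′ j′
  characteristic-cong G H {i′ = i′} {j′} ≟-eq adj-eq degree-eq rewrite ≟-eq | adj-eq =
    +-congˡ (-‿cong (+-congʳ (diagonal ⌊ i′ ≟ j′ ⌋)))
    where
    diagonal : ∀ b → (if b then degree G _ · 1# else 0#) ≈ (if b then degree H _ · 1# else 0#)
    diagonal true  = degree-eq
    diagonal false = refl

  characteristic-≢ : ∀ {n} (G : Graph n) {i j} → i ≢ j → characteristic G i j ≈ - ⟦ adj G i j ⟧
  characteristic-≢ G i≢j rewrite ⌊≟⌋-≢ i≢j = trans (+-identityˡ _) (-‿cong (+-identityˡ _))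

  characteristic-diagonal : ∀ {n} (G : Graph n) i → characteristic G i i ≈ x - degree G i · 1#
  characteristic-diagonal G i rewrite ⌊≟⌋-refl i | adj-irrefl G i = +-congˡ (-‿cong (+-identityʳ _))

  -- One linear formula for diagonal and off-diagonal entries alike, so that a column can be summed
  -- by linearity.
  characteristic-split : ∀ {n} (G : Graph n) i j →
    characteristic G i j ≈ - 1# * ⟦ adj G i j ⟧ + (x - degree G i · 1#) * δ i j
  characteristic-split G i j with i ≟ j
  ... | yes ≡.refl rewrite adj-irrefl G i = begin
    x - (degree G i · 1# + 0#)                ≈⟨ +-congˡ (-‿cong (+-identityʳ _)) ⟩
    x - degree G i · 1#                       ≈⟨ +-identityˡ _ ⟨
    0# + (x - degree G i · 1#)                ≈⟨ +-cong (zeroʳ _) (*-identityʳ _) ⟨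
    - 1# * 0# + (x - degree G i · 1#) * 1#    ∎
  ... | no _ = begin
    0# - (0# + ⟦ adj G i j ⟧)                 ≈⟨ +-identityˡ _ ⟩
    - (0# + ⟦ adj G i j ⟧)                    ≈⟨ -‿cong (+-identityˡ _) ⟩
    - ⟦ adj G i j ⟧                           ≈⟨ -1*x≈-x _ ⟨
    - 1# * ⟦ adj G i j ⟧                      ≈⟨ +-identityʳ _ ⟨
    - 1# * ⟦ adj G i j ⟧ + 0#                 ≈⟨ +-congˡ (zeroʳ _) ⟨
    - 1# * ⟦ adj G i j ⟧ + (x - degree G i · 1#) * 0# ∎

  -- Degrees are counted in the ring: a sum of indicators can be split along the blocks of the
  -- vertex set.
  sum-indicator : ∀ {n} (f : Fin n → Bool) → sum (λ i → ⟦ f i ⟧) ≈ ∣ tabulate f ∣ˢ · 1#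
  sum-indicator {zero}  f = refl
  sum-indicator {suc n} f with f zero
  ... | true  = +-congˡ (sum-indicator (f ∘ suc))
  ... | false = trans (+-identityˡ _) (sum-indicator (f ∘ suc))

  sum-δ : ∀ {n} (j : Fin n) → sum (λ i → δ i j) ≈ 1#
  sum-δ j = trans (sum-cong-≋ λ i → sym (*-identityˡ (δ i j))) (sum-δʳ j (λ _ → 1#))

  sum-combine : ∀ k {p} (t : Vector A (k ℕ.* p)) →
                sum t ≈ sum (λ (i : Fin k) → sum (λ y → t (combine i y)))
  sum-combine zero        t = refl
  sum-combine (suc k) {p} t = trans (sum-↑ p t) (+-congˡ (sum-combine k (λ l → t (p ↑ʳ l))))

  -- In the block of a cone over an r-regular graph every column sums to
  -- pivot r, so adding the rows of the block to pivot r times the row of the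
  -- apex clears the off-diagonal part of the latter.
  pivot : ℕ → A
  pivot r = x - (suc r · 1# + r · 1#)

  -- The entry left in the cleared row of the apex: its diagonal entry x - p scaled by the pivot,
  -- plus one entry -1 from each of the p base vertices.
  coneFactor : ℕ → ℕ → A
  coneFactor p r = pivot r * (x - p · 1#) + p · (- 1#)

  record IsCone {p} (r : ℕ) (H : Graph (suc p)) (w : Fin (suc p)) : Set where
    field
      dominating : degree H w ≡ p
      regular    : Regular r (H -ᵛ w)

    apex-adj : ∀ y → adj H w (punchIn w y) ≡ true
    apex-adj = dominating⇒adj H w dominating

    base-sum : ∀ y → sum (λ z → ⟦ adj (H -ᵛ w) y z ⟧) ≈ r · 1#
    base-sum y = trans (sum-indicator (adj (H -ᵛ w) y)) (reflexive (≡.cong (_· 1#) (regular y)))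

    base-degree : ∀ y → degree H (punchIn w y) · 1# ≈ suc r · 1#
    base-degree y = begin
      degree H (punchIn w y) · 1#                       ≈⟨ sum-indicator (adj H (punchIn w y)) ⟨
      sum (λ z → ⟦ adj H (punchIn w y) z ⟧)             ≈⟨ sum-remove {i = w} (λ z → ⟦ adj H (punchIn w y) z ⟧) ⟩
      ⟦ adj H (punchIn w y) w ⟧ + sum (λ z → ⟦ adj (H -ᵛ w) y z ⟧)
        ≈⟨ +-cong (reflexive (≡.cong ⟦_⟧ (≡.trans (adj-sym H _ _) (apex-adj y)))) (base-sum y) ⟩
      1# + r · 1#                                       ∎

    base : Matrix A p
    base y z = characteristic H (punchIn w y) (punchIn w z)

    -- A column holds x - (r + 1) on the diagonal and -1 for each of the r base neighbours.
    -- Regularity makes the sum the same for all columns.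
    base-columnSum : ∀ z → sum (λ y → base y z) ≈ pivot r
    base-columnSum z = begin
      sum (λ y → base y z)
        ≈⟨ sum-cong-≋ (λ y → trans (characteristic-split H (punchIn w y) (punchIn w z))
             (+-cong (*-congˡ (reflexive (≡.cong ⟦_⟧ (adj-sym H _ _))))
                     (*-cong (+-congˡ (-‿cong (base-degree y)))
                             (δ-injective {f = punchIn w} (punchIn-injective w _ _) y z)))) ⟩
      sum (λ y → - 1# * ⟦ adj (H -ᵛ w) z y ⟧ + (x - suc r · 1#) * δ y z)
        ≈⟨ sum-linear (- 1#) (λ y → ⟦ adj (H -ᵛ w) z y ⟧) (λ y → (x - suc r · 1#) * δ y z) ⟩
      - 1# * sum (λ y → ⟦ adj (H -ᵛ w) z y ⟧) + sum (λ y → (x - suc r · 1#) * δ y z)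
        ≈⟨ +-cong (trans (*-congˡ (base-sum z)) (-1*x≈-x _)) (sum-δʳ z (λ _ → x - suc r · 1#)) ⟩
      - (r · 1#) + (x - suc r · 1#)
        ≈⟨ solve 3 (λ a x b → a :+ (x :+ b) := x :+ (b :+ a)) refl _ _ _ ⟩
      x + (- (suc r · 1#) - r · 1#)
        ≈⟨ +-congˡ (-‿+-comm _ _) ⟩
      pivot r ∎

    φ-cone : pivot r * φ H ≈ coneFactor p r * ∣ base ∣
    φ-cone = begin
      pivot r * φ H                       ≈⟨ *-cong (sym (*-identityʳ _)) (sym (det-permute π (characteristic H))) ⟩
      -- The upper block is the apex alone; weights 1 turn the combination of base rows into the
      -- column sums of the base.
      pivot r ^ 1 * ∣ M ∣                 ≈⟨ det-schurComplement 1 M (pivot r) (λ _ _ → 1#) vanish ⟩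
      ∣ schurComplement 1 M (pivot r) (λ _ _ → 1#) ∣ * ∣ (λ y z → M (suc y) (suc z)) ∣
        ≈⟨ *-cong (trans (solve 1 (λ a → con 1 :* (a :* con 1) :+ con 0 := a) refl _) complement)
                  (det-cong λ y z → reflexive (≡.cong₂ (characteristic H) (π-suc y) (π-suc z))) ⟩
      coneFactor p r * ∣ base ∣           ∎
      where
      -- The vertices are relabelled with the apex in front, as the decomposition 1 + p requires.
      π = Perm.insert zero w Perm.id
      M : Matrix A (suc p)
      M i j = characteristic H (π ⟨$⟩ʳ i) (π ⟨$⟩ʳ j)
      π-suc : ∀ y → π ⟨$⟩ʳ suc y ≡ punchIn w y
      π-suc = Perm.insert-punchIn zero w Perm.id
      M-suc-zero : ∀ y → M (suc y) zero ≈ - 1#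
      M-suc-zero y = begin
        characteristic H (π ⟨$⟩ʳ suc y) w  ≡⟨ ≡.cong (λ i → characteristic H i w) (π-suc y) ⟩
        characteristic H (punchIn w y) w   ≈⟨ characteristic-≢ H (punchInᵢ≢i w y) ⟩
        - ⟦ adj H (punchIn w y) w ⟧        ≡⟨ ≡.cong (λ b → - ⟦ b ⟧) (≡.trans (adj-sym H _ _) (apex-adj y)) ⟩
        - 1#                               ∎
      M-zero-suc : ∀ z → M zero (suc z) ≈ - 1#
      M-zero-suc z = begin
        characteristic H w (π ⟨$⟩ʳ suc z)  ≡⟨ ≡.cong (characteristic H w) (π-suc z) ⟩
        characteristic H w (punchIn w z)   ≈⟨ characteristic-≢ H (punchInᵢ≢i w z ∘ ≡.sym) ⟩
        - ⟦ adj H w (punchIn w z) ⟧        ≡⟨ ≡.cong (λ b → - ⟦ b ⟧) (apex-adj z) ⟩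
        - 1#                               ∎
      vanish : ∀ (i : Fin 1) z → pivot r * M (i ↑ˡ p) (suc z) + sum (λ y → 1# * M (suc y) (suc z)) ≈ 0#
      vanish zero z = begin
        pivot r * M zero (suc z) + sum (λ y → 1# * M (suc y) (suc z))
          ≈⟨ +-cong (*-congˡ (M-zero-suc z)) (sum-cong-≋ λ y → trans (*-identityˡ _)
               (reflexive (≡.cong₂ (characteristic H) (π-suc y) (π-suc z)))) ⟩
        pivot r * - 1# + sum (λ y → base y z)
          ≈⟨ +-cong (trans (*-comm _ _) (-1*x≈-x _)) (base-columnSum z) ⟩
        - pivot r + pivot r ≈⟨ -‿inverseˡ _ ⟩
        0# ∎
      complement : pivot r * M zero zero + sum (λ y → 1# * M (suc y) zero) ≈ coneFactor p r
      complement = +-cong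
        (*-congˡ (trans (characteristic-diagonal H w) (reflexive (≡.cong (λ d → x - d · 1#) dominating))))
        (trans (sum-cong-≋ λ y → trans (*-identityˡ _) (M-suc-zero y)) (sum-replicate p))

  open IsCone

  -- The block structure of a pocket graph

  module _ {n k p : ℕ} (F : Graph n) (v : Fin k → Fin n) (r : ℕ) where

    vertex-elim : ∀ {ℓ′} (P : Fin (n ℕ.+ k ℕ.* p) → Set ℓ′) → (∀ a → P (a ↑ˡ k ℕ.* p)) →
                  (∀ i y → P (n ↑ʳ combine i y)) → ∀ l → P l
    vertex-elim P Pˡ Pʳ l with splitAt n l in eq
    ... | inj₁ a = ≡.subst P (splitAt⁻¹-↑ˡ eq) (Pˡ a)
    ... | inj₂ b with i , y , ≡.refl ← combine-surjective {k} {p} b = ≡.subst P (splitAt⁻¹-↑ʳ eq) (Pʳ i y)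

    -- Row `a` selects the pocket vertices attached at `a`. For a vertex without a pocket the row is
    -- zero, and its row of the characteristic matrix is merely scaled.
    incidence : Fin n → Fin (k ℕ.* p) → A
    incidence a l = δ a (v (quotient p l))

    incidence-combine : ∀ a i y → incidence a (combine i y) ≡ δ a (v i)
    incidence-combine a i y = ≡.cong (λ iy → δ a (v (proj₁ iy))) (remQuot-combine i y)

    module _ (H : Graph (suc p)) (w : Fin (suc p)) (cone : IsCone r H w) where

      private G = G[ F , v , H , w ]

      adj-ˡˡ : ∀ a b → adj G (a ↑ˡ k ℕ.* p) (b ↑ˡ k ℕ.* p) ≡ adj F a b
      adj-ˡˡ a b = ≡.cong₂ (pocketAdj F v H w) (pocketVertex-↑ˡ k p a) (pocketVertex-↑ˡ k p b)

      adj-ˡʳ : ∀ a i y → adj G (a ↑ˡ k ℕ.* p) (n ↑ʳ combine i y) ≡ ⌊ a ≟ v i ⌋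
      adj-ˡʳ a i y = ≡.trans
        (≡.cong₂ (pocketAdj F v H w) (pocketVertex-↑ˡ k p a) (pocketVertex-↑ʳ n i y))
        (≡.trans (≡.cong (⌊ a ≟ v i ⌋ ∧_) (apex-adj cone y)) (∧-identityʳ _))

      adj-ʳʳ : ∀ i y j z → adj G (n ↑ʳ combine i y) (n ↑ʳ combine j z) ≡ ⌊ i ≟ j ⌋ ∧ adj (H -ᵛ w) y z
      adj-ʳʳ i y j z = ≡.cong₂ (pocketAdj F v H w) (pocketVertex-↑ʳ n i y) (pocketVertex-↑ʳ n j z)

      -- Identifying the apex with `v i` preserves the other degrees in the copy: one neighbour in
      -- F, r in the same copy, none in other copies. Hence each diagonal block of the pocket graph
      -- is the base of the cone.
      pocket-degree : ∀ i y → degree G (n ↑ʳ combine i y) · 1# ≈ suc r · 1#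
      pocket-degree i y = begin
        degree G iy · 1#              ≈⟨ sum-indicator (adj G iy) ⟨
        sum (λ l → ⟦ adj G iy l ⟧)    ≈⟨ sum-↑ n (λ l → ⟦ adj G iy l ⟧) ⟩
        sum (λ a → ⟦ adj G iy (a ↑ˡ k ℕ.* p) ⟧) + sum (λ l → ⟦ adj G iy (n ↑ʳ l) ⟧)
          ≈⟨ +-cong (trans (sum-cong-≋ λ a → reflexive (≡.cong ⟦_⟧ (≡.trans (adj-sym G _ _) (adj-ˡʳ a i y)))) (sum-δ (v i)))
                    (trans (sum-combine k _) (trans (sum-single i _ other) same)) ⟩
        1# + r · 1#                   ∎
        where
        iy = n ↑ʳ combine i y
        other : ∀ j → j ≢ i → sum (λ z → ⟦ adj G iy (n ↑ʳ combine j z) ⟧) ≈ 0#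
        other j j≢i = sum-zero λ z → reflexive (≡.cong ⟦_⟧
          (≡.trans (adj-ʳʳ i y j z) (≡.cong (_∧ adj (H -ᵛ w) y z) (⌊≟⌋-≢ (j≢i ∘ ≡.sym)))))
        same : sum (λ z → ⟦ adj G iy (n ↑ʳ combine i z) ⟧) ≈ r · 1#
        same = trans (sum-cong-≋ λ z → reflexive (≡.cong ⟦_⟧
          (≡.trans (adj-ʳʳ i y i z) (≡.cong (_∧ adj (H -ᵛ w) y z) (⌊≟⌋-refl i))))) (base-sum cone y)

      characteristic-ˡʳ : ∀ a i y → characteristic G (a ↑ˡ k ℕ.* p) (n ↑ʳ combine i y) ≈ - δ a (v i)
      characteristic-ˡʳ a i y = trans (characteristic-≢ G (↑ˡ≢↑ʳ a (combine i y)))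
        (-‿cong (reflexive (≡.cong ⟦_⟧ (adj-ˡʳ a i y))))

      characteristic-ʳʳ : ∀ i y j z → characteristic G (n ↑ʳ combine i y) (n ↑ʳ combine j z) ≈
                          (if ⌊ i ≟ j ⌋ then base cone y z else 0#)
      characteristic-ʳʳ i y j z with i ≟ j
      ... | yes ≡.refl = characteristic-cong G H
        (≡.trans (⌊≟⌋-injective {f = λ z → n ↑ʳ combine i z} (λ {y} {z} → combine-injectiveʳ i y i z ∘ ↑ʳ-injective n _ _) y z)
                 (≡.sym (⌊≟⌋-injective {f = punchIn w} (punchIn-injective w _ _) y z)))
        (≡.trans (adj-ʳʳ i y i z) (≡.cong (_∧ adj (H -ᵛ w) y z) (⌊≟⌋-refl i)))
        (trans (pocket-degree i y) (sym (base-degree cone y)))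
      ... | no i≢j = begin
        characteristic G (n ↑ʳ combine i y) (n ↑ʳ combine j z)
          ≈⟨ characteristic-≢ G (i≢j ∘ combine-injectiveˡ i y j z ∘ ↑ʳ-injective n _ _) ⟩
        - ⟦ adj G (n ↑ʳ combine i y) (n ↑ʳ combine j z) ⟧
          ≡⟨ ≡.cong (λ b → - ⟦ b ⟧) (≡.trans (adj-ʳʳ i y j z) (≡.cong (_∧ adj (H -ᵛ w) y z) (⌊≟⌋-≢ i≢j))) ⟩
        - 0# ≈⟨ -0#≈0# ⟩
        0#   ∎

      -- In a column of copy j, the scaled row of `a` has -pivot times `δ a (v j)`. Of the added
      -- rows only those of copy j are nonzero there, and their column sum contributes the opposite
      -- term.
      φ-pockets : pivot r ^ n * φ G ≈
        ∣ schurComplement n (characteristic G) (pivot r) incidence ∣ * ∣ base cone ∣ ^ k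
      φ-pockets = trans
        (det-schurComplement n (characteristic G) (pivot r) incidence (λ a l → vanish a l))
        (*-congˡ (det-blockDiagonal k (base cone) _ characteristic-ʳʳ))
        where
        M = characteristic G
        vanish : ∀ a l → pivot r * M (a ↑ˡ k ℕ.* p) (n ↑ʳ l) + sum (λ l′ → incidence a l′ * M (n ↑ʳ l′) (n ↑ʳ l)) ≈ 0#
        vanish a l with j , z , ≡.refl ← combine-surjective {k} {p} l = begin
          pivot r * M (a ↑ˡ k ℕ.* p) jz + sum (λ l′ → incidence a l′ * M (n ↑ʳ l′) jz)
            ≈⟨ +-cong (*-congˡ (characteristic-ˡʳ a j z)) (trans (sum-combine k _) (trans
                 (sum-cong-≋ λ i → trans (sum-cong-≋ λ y → *-congʳ (reflexive (incidence-combine a i y)))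
                   (sym (*-distribˡ-sum (δ a (v i)) (λ y → M (n ↑ʳ combine i y) jz))))
                 (trans (sum-single j _ other) (*-congˡ same)))) ⟩
          pivot r * - δ a (v j) + δ a (v j) * pivot r
            ≈⟨ +-cong (sym (-‿distribʳ-* _ _)) (*-comm _ _) ⟩
          - (pivot r * δ a (v j)) + pivot r * δ a (v j) ≈⟨ -‿inverseˡ _ ⟩
          0# ∎
          where
          jz = n ↑ʳ combine j z
          other : ∀ i → i ≢ j → δ a (v i) * sum (λ y → M (n ↑ʳ combine i y) jz) ≈ 0#
          other i i≢j = trans (*-congˡ (sum-zero λ y → trans (characteristic-ʳʳ i y j z)
            (reflexive (≡.cong (if_then base cone y z else 0#) (⌊≟⌋-≢ i≢j))))) (zeroʳ _)
          same : sum (λ y → M (n ↑ʳ combine j y) jz) ≈ pivot r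
          same = trans (sum-cong-≋ λ y → trans (characteristic-ʳʳ j y j z)
            (reflexive (≡.cong (if_then base cone y z else 0#) (⌊≟⌋-refl j)))) (base-columnSum cone z)

    -- Only columns of vertices of F occur in the complement. Their entries are fixed by the edges
    -- of F, the attachment to the pockets, which is complete in both graphs, and the degrees of the
    -- vertices of F, which these adjacencies determine.
    schurComplement-cone : ∀ {Hᵤ Hᵥ : Graph (suc p)} {u v′} (Cᵤ : IsCone r Hᵤ u) (Cᵥ : IsCone r Hᵥ v′) →
      schurComplement n (characteristic G[ F , v , Hᵤ , u ]) (pivot r) incidence ≋
      schurComplement n (characteristic G[ F , v , Hᵥ , v′ ]) (pivot r) incidence
    schurComplement-cone {Hᵤ} {Hᵥ} {u} {v′} Cᵤ Cᵥ a b =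
      +-cong (*-congˡ (characteristic-cong Gᵤ Gᵥ ≡.refl (row-eq a _) (reflexive (≡.cong (_· 1#) degree-eq))))
             (sum-cong-≋ λ l → *-congˡ (trans (characteristic-≢ Gᵤ (↑ˡ≢↑ʳ b l ∘ ≡.sym))
               (trans (-‿cong (reflexive (≡.cong ⟦_⟧ (≡.trans (adj-sym Gᵤ _ _) (≡.trans (row-eq b _) (adj-sym Gᵥ _ _))))))
                 (sym (characteristic-≢ Gᵥ (↑ˡ≢↑ʳ b l ∘ ≡.sym))))))
      where
      Gᵤ = G[ F , v , Hᵤ , u ]
      Gᵥ = G[ F , v , Hᵥ , v′ ]
      row-eq : ∀ a l → adj Gᵤ (a ↑ˡ k ℕ.* p) l ≡ adj Gᵥ (a ↑ˡ k ℕ.* p) l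
      row-eq a = vertex-elim _
        (λ b → ≡.trans (adj-ˡˡ Hᵤ u Cᵤ a b) (≡.sym (adj-ˡˡ Hᵥ v′ Cᵥ a b)))
        (λ i y → ≡.trans (adj-ˡʳ Hᵤ u Cᵤ a i y) (≡.sym (adj-ˡʳ Hᵥ v′ Cᵥ a i y)))
      degree-eq : degree Gᵤ (a ↑ˡ k ℕ.* p) ≡ degree Gᵥ (a ↑ˡ k ℕ.* p)
      degree-eq = ≡.cong ∣_∣ˢ (tabulate-cong (row-eq a))

  -- Cancelling the scalar factors

  Cancellable : A → Set _
  Cancellable s = ∀ t u → s * t ≈ s * u → t ≈ u

  ^-cancellable : ∀ {s} → Cancellable s → ∀ n → Cancellable (s ^ n)
  ^-cancellable cancel zero    t u eq = trans (sym (*-identityˡ t)) (trans eq (*-identityˡ u))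
  ^-cancellable {s} cancel (suc n) t u eq = ^-cancellable cancel n t u
    (cancel _ _ (trans (sym (*-assoc s (s ^ n) t)) (trans eq (*-assoc s (s ^ n) u))))

  ^-congˡ : ∀ n {s t} → s ≈ t → s ^ n ≈ t ^ n
  ^-congˡ zero    s≈t = refl
  ^-congˡ (suc n) s≈t = *-cong s≈t (^-congˡ n s≈t)

  φ-pockets-cong : ∀ {n k p r} (F : Graph n) (vs : Fin k → Fin n)
    {Hᵤ Hᵥ : Graph (suc p)} {u v} → IsCone r Hᵤ u → IsCone r Hᵥ v →
    Cancellable (pivot r) → Cancellable (coneFactor p r) →
    φ Hᵤ ≈ φ Hᵥ → φ G[ F , vs , Hᵤ , u ] ≈ φ G[ F , vs , Hᵥ , v ]
  φ-pockets-cong {n} {k} {p} {r} F vs {Hᵤ} {Hᵥ} {u} {v} Cᵤ Cᵥ cancelPivot cancelFactor φ≈ =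
    ^-cancellable cancelPivot n _ _ (begin
      pivot r ^ n * φ G[ F , vs , Hᵤ , u ]     ≈⟨ φ-pockets F vs r Hᵤ u Cᵤ ⟩
      _ * ∣ base Cᵤ ∣ ^ k                      ≈⟨ *-cong (det-cong (schurComplement-cone F vs r Cᵤ Cᵥ)) (^-congˡ k base≈) ⟩
      _ * ∣ base Cᵥ ∣ ^ k                      ≈⟨ φ-pockets F vs r Hᵥ v Cᵥ ⟨
      pivot r ^ n * φ G[ F , vs , Hᵥ , v ]     ∎)
    where
    base≈ : ∣ base Cᵤ ∣ ≈ ∣ base Cᵥ ∣
    base≈ = cancelFactor _ _ (begin
      coneFactor p r * ∣ base Cᵤ ∣ ≈⟨ φ-cone Cᵤ ⟨
      pivot r * φ Hᵤ               ≈⟨ *-congˡ φ≈ ⟩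
      pivot r * φ Hᵥ               ≈⟨ φ-cone Cᵥ ⟩
      coneFactor p r * ∣ base Cᵥ ∣ ∎)

-- Spectra

module _ {c ℓ₁ ℓ₂} (K : HeytingField c ℓ₁ ℓ₂) where
  private
    commutativeRing = HeytingCommutativeRing.commutativeRing (HeytingField.heytingCommutativeRing K)

  open CommutativeRing commutativeRing hiding (zero) renaming (Carrier to A)
  open import Algebra.Definitions.RawSemiring (RawRing.rawSemiring rawRing) using () renaming (_×_ to _·_)
  open PolynomialProperties commutativeRing
  open Polynomial rawRing
  open CharacteristicMatrix polyCommutativeRing X
    using (characteristic; φ; pivot; coneFactor; IsCone; φ-pockets-cong)
  open import Algebra.Definitions.RawSemiring (RawRing.rawSemiring polyRing) using () renaming (_×_ to _·ₚ_)

  constant-· : ∀ n → constant (n · 1#) ≈ₚ n ·ₚ constant 1#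
  constant-· zero    zero    = refl
  constant-· zero    (suc i) = refl
  constant-· (suc n) = S.+-congˡ {constant 1#} {constant (n · 1#)} {n ·ₚ constant 1#} (constant-· n)

  constant-if : ∀ b {a p} → constant a ≈ₚ p → constant (if b then a else 0#) ≈ₚ (if b then p else [])
  constant-if true  a≈p         = a≈p
  constant-if false a≈p zero    = refl
  constant-if false a≈p (suc i) = refl

  constant-signlessLaplacian : ∀ {n} (G : Graph n) i j →
    constant (signlessLaplacian rawRing G i j) ≈ₚ signlessLaplacian polyRing G i j
  constant-signlessLaplacian G i j = S.+-cong
    {constant (degreeMatrix rawRing G i j)} {degreeMatrix polyRing G i j}
    {constant (adjacencyMatrix rawRing G i j)} {adjacencyMatrix polyRing G i j}
    (constant-if ⌊ i ≟ j ⌋ (constant-· (degree G i)))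
    (constant-if (adj G i j) λ _ → refl)

  -- `charPoly` forms the signless Laplacian over K and embeds its entries as constants, while `φ`
  -- forms it directly over K[X]; the two matrices agree up to coefficientwise equality.
  charPoly≈φ : ∀ {n} (G : Graph n) → charPoly (signlessLaplacian rawRing G) ≈ₚ φ G
  charPoly≈φ G = D.det-cong {M = charMatrix (signlessLaplacian rawRing G)} {characteristic G} λ i j →
    S.+-congˡ {if ⌊ i ≟ j ⌋ then X else []}
      (S.-‿cong {constant (signlessLaplacian rawRing G i j)} {signlessLaplacian polyRing G i j}
        (constant-signlessLaplacian G i j))

  X-‿cong : ∀ p μ → p ≈ₚ constant μ → X +ₚ (-ₚ p) ≈ₚ X- μ
  X-‿cong p μ p≈μ = S.+-congˡ {X} { -ₚ p} { -ₚ constant μ} (S.-‿cong {p} {constant μ} p≈μ)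

  X-·≈ : ∀ n → X +ₚ (-ₚ (n ·ₚ constant 1#)) ≈ₚ X- (n · 1#)
  X-·≈ n = X-‿cong (n ·ₚ constant 1#) (n · 1#) λ i → sym (constant-· n i)

  pivot≈ : ∀ r → pivot r ≈ₚ X- (suc r · 1# + r · 1#)
  pivot≈ r = X-‿cong (suc r ·ₚ constant 1# +ₚ r ·ₚ constant 1#) (suc r · 1# + r · 1#)
    (S.+-cong {suc r ·ₚ constant 1#} {constant (suc r · 1#)} {r ·ₚ constant 1#} {constant (r · 1#)}
      (λ i → sym (constant-· (suc r) i)) (λ i → sym (constant-· r i)))

  pivot-cancellable : ∀ r → Cancellable (pivot r)
  pivot-cancellable r = cancellable-resp (pivot r) (X- _) (pivot≈ r) (X-‿cancellable _)

  degree-· : ∀ {d} n p → Degree< d p → Degree< d (n ·ₚ p)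
  degree-· {d} zero p <p = degree-[] d
  degree-· (suc n) p <p = degree-+ p (n ·ₚ p) <p (degree-· n p <p)

  coneFactor-monic : ∀ p r → Monic 2 (coneFactor p r)
  coneFactor-monic p r = monic-+ (pivot r *ₚ (X +ₚ (-ₚ (p ·ₚ constant 1#)))) (p ·ₚ (-ₚ constant 1#))
    (monic-resp (pivot r *ₚ (X +ₚ (-ₚ (p ·ₚ constant 1#)))) ((X- μ) *ₚ (X- (p · 1#)))
      (S.*-cong {pivot r} {X- μ} {X +ₚ (-ₚ (p ·ₚ constant 1#))} {X- (p · 1#)} (pivot≈ r) (X-·≈ p))
      (monic-X-* μ (X- (p · 1#)) (monic-X- (p · 1#))))
    (degree-≤ (p ·ₚ (-ₚ constant 1#)) (s≤s z≤n) (degree-· p (-ₚ constant 1#) (degree-constant (- 1#))))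
    where μ = suc r · 1# + r · 1#

  -- The common spectrum is obtained by splitting the characteristic polynomial of the first pocket
  -- graph; equality of the polynomials makes the same list a spectrum of the second.
  QCospectral-pockets : AlgebraicallyClosed K → ∀ {n k p r} (F : Graph n) (vs : Fin k → Fin n)
    {Hᵤ Hᵥ : Graph (suc p)} {u v} → IsCone r Hᵤ u → IsCone r Hᵥ v →
    QCospectral K Hᵤ Hᵥ → QCospectral K G[ F , vs , Hᵤ , u ] G[ F , vs , Hᵥ , v ]
  QCospectral-pockets closed {p = p} {r} F vs {Hᵤ} {Hᵥ} {u} {v} Cᵤ Cᵥ (λs , Hᵤ≈ , Hᵥ≈)
    with μs , Gᵤ≈ ←
         monic-splits closed _ (charPoly (signlessLaplacian rawRing G[ F , vs , Hᵤ , u ]))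
           (charPoly-monic (signlessLaplacian rawRing G[ F , vs , Hᵤ , u ]))
    = μs , Gᵤ≈ , λ i → trans (charPoly≈φ Gᵥ i) (trans (sym (φ≈ i)) (trans (sym (charPoly≈φ Gᵤ i)) (Gᵤ≈ i)))
    where
    Gᵤ = G[ F , vs , Hᵤ , u ]
    Gᵥ = G[ F , vs , Hᵥ , v ]
    φ≈ : φ Gᵤ ≈ₚ φ Gᵥ
    φ≈ = φ-pockets-cong F vs Cᵤ Cᵥ (pivot-cancellable r)
      (monic-cancellable closed 2 (coneFactor p r) (coneFactor-monic p r))
      λ i → trans (sym (charPoly≈φ Hᵤ i)) (trans (Hᵤ≈ i) (trans (sym (Hᵥ≈ i)) (charPoly≈φ Hᵥ i)))

corollary3p7 : ∀ {c ℓ₁ ℓ₂} (K : HeytingField c ℓ₁ ℓ₂) →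
    CharacteristicZero K → AlgebraicallyClosed K →
    ∀ (n : ℕ) → 1 ≤ n → (F : Graph n) →
    ∀ (k : ℕ) (vs : Fin k → Fin n) → Injective _≡_ _≡_ vs →
    ∀ (p : ℕ) → 2 ≤ suc p →
    (Hu Hv : Graph (suc p)) (u v : Fin (suc p)) →
    degree Hu u ≡ suc p ∸ 1 → degree Hv v ≡ suc p ∸ 1 →
    ∀ (r₁ : ℕ) → 1 ≤ r₁ →
    Regular r₁ (Hu -ᵛ u) → Regular r₁ (Hv -ᵛ v) →
    QCospectral K Hu Hv →
    QCospectral K G[ F , vs , Hu , u ] G[ F , vs , Hv , v ]
corollary3p7 K _ closed _ _ F _ vs _ _ _ _ _ _ _ degree-u degree-v _ _ regular-u regular-v =
  QCospectral-pockets K closed F vs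
    -- `suc p ∸ 1` computes to `p`, the number of base vertices, so the degree hypothesis is
    -- domination as it stands.
    (record { dominating = degree-u ; regular = regular-u })
    (record { dominating = degree-v ; regular = regular-v })
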